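{- Let $N\in\mathbb{N}$ (so $N\geq 1$), let $\{r_i\}_{i=1}^N$ be a collection of real numbers, and let $0<\delta<\frac{3^{1-N}}{18}$. Then $\bigcap_{i=1}^N\left(\mathbf{Bad}(\delta)+r_i\right)$ is a dense subset of $\mathbb{R}$, and, moreover, $$\dim_H\left(\bigcap_{i=1}^N\left(\mathbf{Bad}(\delta)+r_i\right)\right)\ge \frac{N\log\left(\left\lfloor\left(\frac{1}{18\delta\cdot 3^{N-1}}\right)^{1/N}\right\rfloor\right)}{\log\left(\frac1{6\delta}\right)}.$$
   Context: $\dim_H$ denotes Hausdorff dimension and $\lfloor\cdot\rfloor$ the floor function. For $\delta>0$, $\mathbf{Bad}(\delta)$ denotes the set of irrational real numbers $x$ for which there exists an integer $Q>0$ (depending on $x$) such that $|x-p/q|\ge \delta/q^2$ for all integers $q\ge Q$ and all integers $p$ coprime to $q$. For $E\subset\mathbb{R}$ and $r\in\mathbb{R}$, $E+r=\{x+r:x\in E\}$. -}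

module Defs where

open import Algebra.Bundles using (CommutativeRing; Semiring)
import Algebra.Construct.NaturalChoice.Max as Max
import Algebra.Definitions.RawSemiring as RawSemiringOps
open import Axiom.ExcludedMiddle using (ExcludedMiddle)
open import Data.Bool.Base using (if_then_else_)
open import Data.Empty using (⊥-elim)
open import Data.Fin.Base using (toℕ)
open import Data.Integer.Base as ℤ using (ℤ; +_; -[1+_]; 0ℤ)
open import Data.Integer.Coprimality using (Coprime)
open import Data.Nat.Base as ℕ using (ℕ; suc; _!)
open import Data.Product.Base using (Σ; ∃; ∃-syntax; _×_; _,_; proj₁; proj₂)
open import Data.Rational.Base using (ℚ; ↥_; ↧_)
open import Level using (Level; 0ℓ)
open import Relation.Binary.Bundles using (TotalOrder)
import Relation.Binary.Construct.Add.Supremum.Equality as AddSupEquality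
import Relation.Binary.Construct.Add.Supremum.NonStrict as AddSupOrder
import Relation.Binary.Construct.NonStrictToStrict as ToStrict
open import Relation.Binary.Core using (Rel)
open import Relation.Binary.Structures using (IsTotalOrder)
open import Relation.Nullary.Construct.Add.Supremum using (_⁺; ⊤⁺; [_])
open import Relation.Nullary.Decidable.Core using (Dec; yes; no; does)
open import Relation.Nullary.Negation.Core using (¬_)
open import Relation.Unary using (Pred; Satisfiable; _∈_; _⊆_)

private
  variable
    a p : Level

-- The real numbers, axiomatised as a Dedekind-complete ordered field; this
-- determines them up to a unique isomorphism.  The equality is a setoid
-- equality so that, given excluded middle, both Cauchy sequences and Dedekind
-- cuts are models.  The inverse is total, with no constraint on its value at 0#.

record RealField : Set₁ where
  field
    commutativeRing : CommutativeRing 0ℓ 0ℓ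

  open CommutativeRing commutativeRing public

  infix  4 _≤_
  infix  8 _⁻¹

  field
    _≤_          : Rel Carrier 0ℓ
    isTotalOrder : IsTotalOrder _≈_ _≤_
    +-monoˡ-≤    : ∀ z {x y} → x ≤ y → x + z ≤ y + z
    *-nonNeg     : ∀ {x y} → 0# ≤ x → 0# ≤ y → 0# ≤ x * y
    0≉1          : ¬ (0# ≈ 1#)
    _⁻¹          : Carrier → Carrier
    ⁻¹-inverseʳ  : ∀ {x} → ¬ (x ≈ 0#) → x * x ⁻¹ ≈ 1#

  UpperBound : Pred Carrier 0ℓ → Pred Carrier 0ℓ
  UpperBound P u = ∀ {x} → x ∈ P → x ≤ u

  IsSupremum : Pred Carrier 0ℓ → Pred Carrier 0ℓ
  IsSupremum P u = UpperBound P u × (∀ {v} → UpperBound P v → u ≤ v)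

  field
    complete : ∀ P → Satisfiable P → Satisfiable (UpperBound P) → ∃ (IsSupremum P)

  totalOrder : TotalOrder 0ℓ 0ℓ 0ℓ
  totalOrder = record { isTotalOrder = isTotalOrder }

  open ToStrict _≈_ _≤_ public using (_<_)
  open Max totalOrder public using (_⊔_)
  open RawSemiringOps (Semiring.rawSemiring semiring) public using (_^_; sum) renaming (_×_ to _·_)

  infixl 7 _/_

  _/_ : Carrier → Carrier → Carrier
  x / y = x * y ⁻¹

  ∣_∣ : Carrier → Carrier
  ∣ x ∣ = x ⊔ (- x)

  fromℕ : ℕ → Carrier
  fromℕ n = n · 1#

  fromℤ : ℤ → Carrier
  fromℤ (+ n)    = fromℕ n
  fromℤ -[1+ n ] = - fromℕ (suc n)

  fromℚ : ℚ → Carrier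
  fromℚ r = fromℤ (↥ r) / fromℤ (↧ r)

  infixr 8 _^ℤ_

  _^ℤ_ : Carrier → ℤ → Carrier
  x ^ℤ (+ n)    = x ^ n
  x ^ℤ -[1+ n ] = (x ^ suc n) ⁻¹

-- Everything below takes place in classical mathematics.  As excluded middle
-- decides arbitrary types and not only propositions, it provides a choice
-- operator, through which limits, suprema, logarithms and so on become total
-- functions; they have a default value where the object does not exist.

module Analysis (lem : ∀ {ℓ} → ExcludedMiddle ℓ) (ℝ : RealField) where

  open RealField ℝ

  choose : {A : Set a} → A → Pred A p → A
  choose default P with lem {P = Satisfiable P}
  ... | yes (x , _) = x
  ... | no _        = default

  choose-satisfies : {A : Set a} (d : A) (P : Pred A p) → Satisfiable P → choose d P ∈ P
  choose-satisfies d P sat with lem {P = Satisfiable P}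
  ... | yes (_ , Px) = Px
  ... | no ¬sat      = ⊥-elim (¬sat sat)

  sup : Pred Carrier 0ℓ → Carrier
  sup P = choose 0# (IsSupremum P)

  ⌊_⌋ : Carrier → ℤ
  ⌊ x ⌋ = choose 0ℤ λ n → fromℤ n ≤ x × x < fromℤ n + 1#

  -- Exponential, logarithm, real powers

  partialSum : (ℕ → Carrier) → ℕ → Carrier
  partialSum f n = sum {n} λ i → f (toℕ i)

  _ConvergesTo_ : (ℕ → Carrier) → Carrier → Set
  f ConvergesTo l = ∀ ε → 0# < ε → ∃[ K ] ∀ n → K ℕ.≤ n → ∣ f n - l ∣ < ε

  exp : Carrier → Carrier
  exp x = choose 0# λ y → partialSum (λ k → x ^ k / fromℕ (k !)) ConvergesTo y

  log : Carrier → Carrier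
  log x = choose 0# λ y → exp y ≈ x

  infixr 8 _^ʳ_

  -- Meant for nonnegative bases only, with 0 ^ 0 = 1.
  _^ʳ_ : Carrier → Carrier → Carrier
  x ^ʳ s =
    if does (lem {P = 0# < x}) then exp (s * log x)
    else if does (lem {P = s ≈ 0#}) then 1#
    else 0#

  -- ℝ ∪ {∞}

  ℝ∞ : Set
  ℝ∞ = Carrier ⁺

  open AddSupOrder _≤_ public renaming (_≤⁺_ to _≤∞_)
  open AddSupEquality _≈_ public renaming (_≈⁺_ to _≈∞_)

  module _ {I : Set a} (f : I → ℝ∞) where

    IsGreatestLowerBound : ℝ∞ → Set a
    IsGreatestLowerBound v = (∀ i → v ≤∞ f i) × (∀ w → (∀ i → w ≤∞ f i) → w ≤∞ v)

    IsLeastUpperBound : ℝ∞ → Set a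
    IsLeastUpperBound v = (∀ i → f i ≤∞ v) × (∀ w → (∀ i → f i ≤∞ w) → v ≤∞ w)

    ⨅ : ℝ∞
    ⨅ = choose ⊤⁺ IsGreatestLowerBound

    ⨆ : ℝ∞
    ⨆ = choose ⊤⁺ IsLeastUpperBound

  -- The sum of a series with nonnegative terms.
  Σ∞ : (ℕ → Carrier) → ℝ∞
  Σ∞ f = ⨆ λ n → [ partialSum f n ]

  -- Hausdorff measure and dimension

  Subset : Set₁
  Subset = Pred Carrier 0ℓ

  DiamAtMost : Carrier → Subset → Set
  DiamAtMost η U = ∀ {x y} → x ∈ U → y ∈ U → ∣ x - y ∣ ≤ η

  -- Only used for bounded sets.
  diam : Subset → Carrier
  diam U = sup λ d → ∃[ x ] ∃[ y ] x ∈ U × y ∈ U × d ≈ ∣ x - y ∣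

  -- (diam U)ˢ, with the empty set contributing 0 even when s = 0.
  diamPower : Carrier → Subset → Carrier
  diamPower s U = if does (lem {P = Satisfiable U}) then diam U ^ʳ s else 0#

  -- Finite covers are included, since the sets may be empty.
  record Cover (η : Carrier) (E : Subset) : Set₁ where
    field
      part   : ℕ → Subset
      covers : ∀ {x} → x ∈ E → ∃[ n ] x ∈ part n
      fine   : ∀ n → DiamAtMost η (part n)

  hausdorffPreMeasure : Carrier → Carrier → Subset → ℝ∞
  hausdorffPreMeasure s η E =
    ⨅ λ (C : Cover η E) → Σ∞ λ n → diamPower s (Cover.part C n)

  hausdorffMeasure : Carrier → Subset → ℝ∞
  hausdorffMeasure s E =
    ⨆ λ (η : Σ Carrier (0# <_)) → hausdorffPreMeasure s (proj₁ η) E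

  dimH : Subset → ℝ∞
  dimH E =
    ⨅ λ (s : ∃[ s ] (0# ≤ s) × (hausdorffMeasure s E ≈∞ [ 0# ])) → [ proj₁ s ]

  Dense : Subset → Set
  Dense E = ∀ x ε → 0# < ε → ∃[ y ] y ∈ E × ∣ x - y ∣ < ε

  Irrational : Subset
  Irrational x = ∀ (r : ℚ) → ¬ (x ≈ fromℚ r)

  Bad : Carrier → Subset
  Bad δ x = Irrational x ×
    (∃[ Q ] 0ℤ ℤ.< Q ×
      (∀ (p q : ℤ) → Q ℤ.≤ q → Coprime p q →
        δ / fromℤ q ^ 2 ≤ ∣ x - fromℤ p / fromℤ q ∣))

  infixl 6 _⊕_

  _⊕_ : Subset → Carrier → Subset
  (E ⊕ r) y = ∃[ x ] x ∈ E × y ≈ x + r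

{-# OPTIONS --safe #-}

module Submission where

import Algebra.Construct.NaturalChoice.Max as Max
import Algebra.Properties.AbelianGroup as AbelianGroupProperties
import Algebra.Properties.CommutativeSemiring.Exp as Exp
import Algebra.Properties.Ring as RingProperties
import Algebra.Properties.Semiring.Mult as Mult
import Algebra.Properties.Semiring.Mult.TCOptimised as Mult′
import Algebra.Solver.Ring as Solver
open import Algebra.Solver.Ring.AlmostCommutativeRing
  using (AlmostCommutativeRing; fromCommutativeRing; _-Raw-AlmostCommutative⟶_)
open import Axiom.ExcludedMiddle using (ExcludedMiddle)
open import Data.Bool.Base using (if_then_else_)
open import Data.Empty using (⊥; ⊥-elim)
open import Data.Fin.Base using (Fin; toℕ)
open import Data.Fin.Properties using (toℕ-injective; toℕ-fromℕ<; toℕ<n)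
open import Data.Integer.Base as ℤ using (ℤ; +_; -[1+_]; 0ℤ; 1ℤ)
open import Data.Integer.Coprimality using (Coprime)
import Data.Integer.Properties as ℤ
open import Data.List.Base using (List; []; _∷_; _++_; concat; applyUpTo)
open import Data.List.Relation.Unary.All as All using (All; []; _∷_)
import Data.List.Relation.Unary.All.Properties as All
open import Data.List.Relation.Unary.AllPairs as AllPairs using (AllPairs; []; _∷_)
import Data.List.Relation.Unary.AllPairs.Properties as AllPairs
open import Data.Maybe.Base using (Maybe; just; nothing)
open import Data.Nat.Base as ℕ using (ℕ; zero; suc; NonZero; _!)
open import Data.Nat.DivMod using (_mod_; [m+kn]%n≡m%n; m<n⇒m%n≡m)
import Data.Nat.Properties as ℕ
open import Data.Product.Base using (Σ; ∃; ∃-syntax; _×_; _,_; proj₁; proj₂)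
open import Data.Rational.Base as ℚ using (↥_; ↧_)
import Data.Sign.Base as Sign
open import Data.Sum.Base using (_⊎_; inj₁; inj₂; [_,_]′)
open import Function.Base using (_∘_)
open import Relation.Binary.Bundles using (TotalOrder)
import Relation.Binary.Construct.NonStrictToStrict as NonStrictToStrict
open import Relation.Binary.PropositionalEquality.Core as ≡ using (_≡_)
import Relation.Binary.Reasoning.PartialOrder as PartialOrderReasoning
open import Relation.Nullary.Construct.Add.Supremum using (⊤⁺; [_])
open import Relation.Nullary.Decidable.Core using (Dec; yes; no; does)
open import Relation.Nullary.Negation.Core using (¬_)
open import Relation.Unary using (_∈_; Satisfiable; ⋂)
open import Defs

-- The sets are intersected by Schmidt's game.  Put γ = (6δ)^(1/N), so that
-- 3mγ ≤ 1, and let a node at depth k be an interval of length proportional to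
-- γ^k.  The rationals p/q with q² times that length less than 1 are further apart
-- than the interval is long; so the neighbourhoods of radius one sixth of the
-- length around their translates by r (k mod N) miss one of the three thirds of
-- the interval, and the m children of the node are placed in that third.  Every
-- translation gets its turn again after N levels, when the length has shrunk by
-- 6δ, which makes all limit points badly approximable with constant δ in each
-- translate, and irrational.
--
-- For the dimension, let the Hausdorff sum of a cover with exponent t below the
-- claimed bound be small.  A set of diameter less than the length at depth d meets
-- at most two nodes of that depth, a proportion 2 m^(-d) of them, which is at most
-- a constant times its diameter to the power t.  If these proportions have sum
-- less than 1, then so they have below some child of every node where they do,
-- and the limit of the resulting path is not covered.

-- Two requirements fix the constants. If p/q is avoided at depth k + N but came too early for the
-- previous turn of the same translation, at depth k with length ℓ, then q² ℓ ≥ 1; the distance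
-- gained, γ^N ℓ / 6, has to be at least δ / q², whence γ^N = 6 δ. The m children have to fit into a
-- third, so 3 m γ ≤ 1, whose Nth power reads m^N ≤ 1 / (18 δ 3^(N-1)). The floor in the statement
-- is the largest such m, and log m / log (1/γ) is the claimed bound.
--
-- Each level serves one translation only, since the spacing of rationals holds within one translate
-- and nothing separates those of two different ones.
--
-- A cover may consist of infinitely many arbitrary sets, so no finite depth settles which nodes are
-- covered. Proportions taken at a depth chosen separately for each set replace a mass distribution,
-- and averaging over finitely many children replaces compactness. Points and empty sets may add
-- nothing to the Hausdorff sum; as m ≥ 2, they are measured so deep that their proportions form a
-- small geometric series. For m = 1 the claimed bound is 0.

module DimensionBound (lem : ∀ {ℓ} → ExcludedMiddle ℓ) (ℝ : RealField) where

  open RealField ℝ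
  open Analysis lem ℝ
  open TotalOrder totalOrder using (poset; antisym; total; ≤-respˡ-≈; ≤-respʳ-≈)
    renaming (refl to ≤-refl; reflexive to ≤-reflexive; trans to ≤-trans)
  open PartialOrderReasoning poset
  open RingProperties ring using (-‿distribˡ-*; -‿distribʳ-*; -0#≈0#)
  open AbelianGroupProperties +-abelianGroup using () renaming (⁻¹-∙-comm to -‿+-comm; ⁻¹-involutive to -‿involutive)

  -- Integers in the field, and the ring solver

  private
    module Natural = Mult′ semiring

  natural : ℕ → Carrier
  natural n = n Natural.× 1#

  -- Unlike fromℤ this sends 1ℤ to 1# definitionally, as the solver needs.
  integer : ℤ → Carrier
  integer (+ n)    = natural n
  integer -[1+ n ] = - natural (suc n)

  integer-neg : ∀ i → integer (ℤ.- i) ≈ - integer i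
  integer-neg (+ zero)    = sym -0#≈0#
  integer-neg (+ suc n)   = refl
  integer-neg -[1+ n ]    = sym (-‿involutive _)

  integer-⊖ : ∀ m n → integer (m ℤ.⊖ n) ≈ natural m - natural n
  integer-⊖ m zero = trans (sym (+-identityʳ _)) (+-congˡ (sym -0#≈0#))
  integer-⊖ zero (suc n) = sym (+-identityˡ _)
  integer-⊖ (suc m) (suc n) = begin-equality
    integer (suc m ℤ.⊖ suc n)                     ≈⟨ reflexive (≡.cong integer (ℤ.[1+m]⊖[1+n]≡m⊖n m n)) ⟩
    integer (m ℤ.⊖ n)                             ≈⟨ integer-⊖ m n ⟩
    natural m - natural n                         ≈⟨ +-identityˡ _ ⟨
    0# + (natural m - natural n)                  ≈⟨ +-congʳ (-‿inverseʳ 1#) ⟨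
    (1# - 1#) + (natural m - natural n)           ≈⟨ +-assoc _ _ _ ⟩
    1# + (- 1# + (natural m - natural n))         ≈⟨ +-congˡ (+-assoc _ _ _) ⟨
    1# + ((- 1# + natural m) - natural n)         ≈⟨ +-congˡ (+-congʳ (+-comm _ _)) ⟩
    1# + ((natural m - 1#) - natural n)           ≈⟨ +-congˡ (+-assoc _ _ _) ⟩
    1# + (natural m + (- 1# - natural n))         ≈⟨ +-assoc _ _ _ ⟨
    (1# + natural m) + (- 1# - natural n)
      ≈⟨ +-cong (sym (Natural.1+× m 1#)) (trans (-‿+-comm 1# (natural n)) (-‿cong (sym (Natural.1+× n 1#)))) ⟩
    natural (suc m) - natural (suc n)             ∎

  integer-+ : ∀ i j → integer (i ℤ.+ j) ≈ integer i + integer j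
  integer-+ (+ m)    (+ n)    = Natural.×-homo-+ 1# m n
  integer-+ (+ m)    -[1+ n ] = integer-⊖ m (suc n)
  integer-+ -[1+ m ] (+ n)    = trans (integer-⊖ n (suc m)) (+-comm _ _)
  integer-+ -[1+ m ] -[1+ n ] = begin-equality
    - natural (suc (suc (m ℕ.+ n)))          ≈⟨ reflexive (≡.cong (λ k → - natural (suc k)) (ℕ.+-suc m n)) ⟨
    - natural (suc m ℕ.+ suc n)              ≈⟨ -‿cong (Natural.×-homo-+ 1# (suc m) (suc n)) ⟩
    - (natural (suc m) + natural (suc n))    ≈⟨ -‿+-comm _ _ ⟨
    - natural (suc m) - natural (suc n)      ∎

  private
    -- Integer multiplication works by sign and magnitude, so a product of opposite signs appears in
    -- this form, which is not a negative constructor when the magnitude is zero.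
    integer-neg-◃ : ∀ n → integer (Sign.- ℤ.◃ n) ≈ - natural n
    integer-neg-◃ zero    = sym -0#≈0#
    integer-neg-◃ (suc n) = refl

  integer-* : ∀ i j → integer (i ℤ.* j) ≈ integer i * integer j
  integer-* (+ m)    (+ n)    = trans (reflexive (≡.cong integer (≡.sym (ℤ.pos-* m n)))) (Natural.×1-homo-* m n)
  integer-* (+ m)    -[1+ n ] =
    trans (integer-neg-◃ (m ℕ.* suc n)) (trans (-‿cong (Natural.×1-homo-* m (suc n))) (-‿distribʳ-* _ _))
  integer-* -[1+ m ] (+ n)    =
    trans (integer-neg-◃ (suc m ℕ.* n)) (trans (-‿cong (Natural.×1-homo-* (suc m) n)) (-‿distribˡ-* _ _))
  integer-* -[1+ m ] -[1+ n ] = begin-equality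
    natural (suc m ℕ.* suc n)                  ≈⟨ Natural.×1-homo-* (suc m) (suc n) ⟩
    natural (suc m) * natural (suc n)          ≈⟨ -‿involutive _ ⟨
    - - (natural (suc m) * natural (suc n))    ≈⟨ -‿cong (-‿distribˡ-* _ _) ⟩
    - (- natural (suc m) * natural (suc n))    ≈⟨ -‿distribʳ-* _ _ ⟩
    - natural (suc m) * - natural (suc n)      ∎

  private
    almostCommutativeRing : AlmostCommutativeRing _ _
    almostCommutativeRing = fromCommutativeRing commutativeRing

    integerHomomorphism : ℤ.+-*-rawRing -Raw-AlmostCommutative⟶ almostCommutativeRing
    integerHomomorphism = record
      { ⟦_⟧    = integer
      ; +-homo = integer-+
      ; *-homo = integer-*
      ; -‿homo = integer-neg
      ; 0-homo = refl
      ; 1-homo = refl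
      }

    integer-≟ : ∀ i j → Maybe (integer i ≈ integer j)
    integer-≟ i j with i ℤ.≟ j
    ... | yes ≡.refl = just refl
    ... | no _       = nothing

  open Solver ℤ.+-*-rawRing almostCommutativeRing integerHomomorphism integer-≟ using (solve; _:=_; _:+_; _:*_; _:-_; :-_; con)

  -- Arithmetic of the ordered field

  <⇒≤ : ∀ {x y} → x < y → x ≤ y
  <⇒≤ = proj₁

  ≤∨> : ∀ x y → x ≤ y ⊎ y < x
  ≤∨> x y with lem {P = x ≤ y}
  ... | yes x≤y = inj₁ x≤y
  ... | no  x≰y = inj₂ (NonStrictToStrict.≰⇒> _≈_ _≤_ sym ≤-reflexive total x≰y)

  <⇒≱ : ∀ {x y} → x < y → ¬ y ≤ x
  <⇒≱ = NonStrictToStrict.<⇒≱ _≈_ _≤_ antisym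

  ≰⇒> : ∀ {x y} → ¬ x ≤ y → y < x
  ≰⇒> = NonStrictToStrict.≰⇒> _≈_ _≤_ sym ≤-reflexive total

  ≮⇒≥ : ∀ {x y} → ¬ x < y → y ≤ x
  ≮⇒≥ {x} {y} x≮y = [ (λ y≤x → y≤x) , ⊥-elim ∘ x≮y ]′ (≤∨> y x)

  ≤-<-trans : ∀ {x y z} → x ≤ y → y < z → x < z
  ≤-<-trans = NonStrictToStrict.≤-<-trans _≈_ _≤_ ≤-trans antisym ≤-respˡ-≈

  <-≤-trans : ∀ {x y z} → x < y → y ≤ z → x < z
  <-≤-trans = NonStrictToStrict.<-≤-trans _≈_ _≤_ sym ≤-trans antisym ≤-respʳ-≈

  <-trans : ∀ {x y z} → x < y → y < z → x < z
  <-trans x<y y<z = <-≤-trans x<y (<⇒≤ y<z)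

  <-respˡ : ∀ {x y z} → x ≈ y → x < z → y < z
  <-respˡ x≈y x<z = ≤-<-trans (≤-reflexive (sym x≈y)) x<z

  <-respʳ : ∀ {x y z} → y ≈ z → x < y → x < z
  <-respʳ y≈z x<y = <-≤-trans x<y (≤-reflexive y≈z)

  <-irrefl : ∀ {x} → ¬ x < x
  <-irrefl x<x = <⇒≱ x<x ≤-refl

  +-monoʳ-≤ : ∀ z {x y} → x ≤ y → z + x ≤ z + y
  +-monoʳ-≤ z {x} {y} x≤y = ≤-respˡ-≈ (+-comm x z) (≤-respʳ-≈ (+-comm y z) (+-monoˡ-≤ z x≤y))

  infixl 6 _⊹_ _⊹<_

  _⊹_ : ∀ {x y z w} → x ≤ y → z ≤ w → x + z ≤ y + w
  x≤y ⊹ z≤w = ≤-trans (+-monoˡ-≤ _ x≤y) (+-monoʳ-≤ _ z≤w)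

  -- The way linear inequalities are proved throughout: the equation says that `b - a` equals
  -- `d - c`, written without subtraction as an identity for the ring solver.
  ≤-cancel : ∀ {a b c d} → c ≤ d → b + c ≈ a + d → a ≤ b
  ≤-cancel {a} {b} {c} {d} c≤d b+c≈a+d = begin
    a                ≈⟨ (solve 2 (λ a d → a := (a :+ d) :+ :- d) refl a d) ⟩
    (a + d) + - d    ≈⟨ +-congʳ b+c≈a+d ⟨
    (b + c) + - d    ≤⟨ +-monoˡ-≤ (- d) (+-monoʳ-≤ b c≤d) ⟩
    (b + d) + - d    ≈⟨ (solve 2 (λ b d → (b :+ d) :+ :- d := b) refl b d) ⟩
    b                ∎

  <-cancel : ∀ {a b c d} → c < d → b + c ≈ a + d → a < b
  <-cancel {a} {b} {c} {d} c<d b+c≈a+d = ≰⇒> λ b≤a → <⇒≱ c<d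
    (≤-cancel b≤a (trans (+-comm c b) (trans b+c≈a+d (+-comm a d))))

  _⊹<_ : ∀ {x y z w} → x ≤ y → z < w → x + z < y + w
  _⊹<_ {x} {y} {z} {w} x≤y z<w = ≤-<-trans (+-monoˡ-≤ z x≤y) (<-cancel z<w
      (solve 3 (λ y w z →
          (y :+ w) :+ z :=
          (y :+ z) :+ w) refl
        y w z))

  difference-nonNeg : ∀ {x y} → x ≤ y → 0# ≤ y - x
  difference-nonNeg {x} {y} x≤y = ≤-cancel x≤y (solve 2 (λ y x → (y :- x) :+ x := (con (+ 0)) :+ y) refl y x)

  difference-pos : ∀ {x y} → x < y → 0# < y - x
  difference-pos {x} {y} x<y = <-cancel x<y (solve 2 (λ y x → (y :- x) :+ x := (con (+ 0)) :+ y) refl y x)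

  +-nonNeg : ∀ {x y} → 0# ≤ x → 0# ≤ y → 0# ≤ x + y
  +-nonNeg 0≤x 0≤y = ≤-respˡ-≈ (+-identityˡ 0#) (0≤x ⊹ 0≤y)

  +-pos : ∀ {x y} → 0# ≤ x → 0# < y → 0# < x + y
  +-pos 0≤x 0<y = <-respˡ (+-identityˡ 0#) (0≤x ⊹< 0<y)

  *-monoʳ-≤ : ∀ {x y} z → 0# ≤ z → x ≤ y → z * x ≤ z * y
  *-monoʳ-≤ {x} {y} z 0≤z x≤y = ≤-cancel (*-nonNeg 0≤z (difference-nonNeg x≤y))
      (solve 3 (λ z y x →
          z :* y :+ (con (+ 0)) :=
          z :* x :+ z :* (y :- x)) refl
        z y x)

  *-monoˡ-≤ : ∀ {x y} z → 0# ≤ z → x ≤ y → x * z ≤ y * z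
  *-monoˡ-≤ {x} {y} z 0≤z x≤y = ≤-respˡ-≈ (*-comm z x) (≤-respʳ-≈ (*-comm z y) (*-monoʳ-≤ z 0≤z x≤y))

  *-mono-≤ : ∀ {x y z w} → 0# ≤ x → x ≤ y → 0# ≤ z → z ≤ w → x * z ≤ y * w
  *-mono-≤ 0≤x x≤y 0≤z z≤w = ≤-trans (*-monoˡ-≤ _ 0≤z x≤y) (*-monoʳ-≤ _ (≤-trans 0≤x x≤y) z≤w)

  zero-product : ∀ {x y} → x * y ≈ 0# → ¬ x ≈ 0# → y ≈ 0#
  zero-product {x} {y} xy≈0 x≉0 = begin-equality
    y                 ≈⟨ *-identityˡ y ⟨
    1# * y            ≈⟨ *-congʳ (⁻¹-inverseʳ x≉0) ⟨
    x * x ⁻¹ * y      ≈⟨ (solve 3 (λ z0 x y → x :* z0 :* y := z0 :* (x :* y)) refl (x ⁻¹) x y) ⟩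
    x ⁻¹ * (x * y)    ≈⟨ *-congˡ xy≈0 ⟩
    x ⁻¹ * 0#         ≈⟨ zeroʳ _ ⟩
    0#                ∎

  *-pos : ∀ {x y} → 0# < x → 0# < y → 0# < x * y
  *-pos (0≤x , 0≉x) (0≤y , 0≉y) = *-nonNeg 0≤x 0≤y , λ 0≈xy → 0≉y (sym (zero-product (sym 0≈xy) (0≉x ∘ sym)))

  *-monoʳ-< : ∀ {x y} z → 0# < z → x < y → z * x < z * y
  *-monoʳ-< {x} {y} z 0<z x<y = <-cancel (*-pos 0<z (difference-pos x<y))
      (solve 3 (λ z y x →
          z :* y :+ (con (+ 0)) :=
          z :* x :+ z :* (y :- x)) refl
        z y x)

  *-monoˡ-< : ∀ {x y} z → 0# < z → x < y → x * z < y * z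
  *-monoˡ-< {x} {y} z 0<z x<y = <-respˡ (*-comm z x) (<-respʳ (*-comm z y) (*-monoʳ-< z 0<z x<y))

  *-cancelʳ-≤ : ∀ {x y} z → 0# < z → x * z ≤ y * z → x ≤ y
  *-cancelʳ-≤ z 0<z xz≤yz = ≮⇒≥ λ y<x → <⇒≱ (*-monoˡ-< z 0<z y<x) xz≤yz

  *-cancelʳ-< : ∀ {x y} z → 0# ≤ z → x * z < y * z → x < y
  *-cancelʳ-< z 0≤z xz<yz = ≰⇒> λ y≤x → <⇒≱ xz<yz (*-monoˡ-≤ z 0≤z y≤x)

  *-cancelʳ-≈ : ∀ {x y} z → 0# < z → x * z ≈ y * z → x ≈ y
  *-cancelʳ-≈ z 0<z eq = antisym (*-cancelʳ-≤ z 0<z (≤-reflexive eq)) (*-cancelʳ-≤ z 0<z (≤-reflexive (sym eq)))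

  square-nonNeg : ∀ x → 0# ≤ x * x
  square-nonNeg x with total 0# x
  ... | inj₁ 0≤x = *-nonNeg 0≤x 0≤x
  ... | inj₂ x≤0 = ≤-respʳ-≈
      (solve 1 (λ x →
          ((con (+ 0)) :- x) :* ((con (+ 0)) :- x) :=
          x :* x) refl
        x) (*-nonNeg (difference-nonNeg x≤0) (difference-nonNeg x≤0))

  0<1 : 0# < 1#
  0<1 = ≤-respʳ-≈ (*-identityˡ 1#) (square-nonNeg 1#) , 0≉1

  0≤1 : 0# ≤ 1#
  0≤1 = <⇒≤ 0<1

  x<x+y : ∀ x {y} → 0# < y → x < x + y
  x<x+y x {y} 0<y = <-cancel 0<y (solve 2 (λ x y → (x :+ y) :+ (con (+ 0)) := x :+ y) refl x y)

  x≤x+y : ∀ x {y} → 0# ≤ y → x ≤ x + y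
  x≤x+y x {y} 0≤y = ≤-cancel 0≤y (solve 2 (λ x y → (x :+ y) :+ (con (+ 0)) := x :+ y) refl x y)

  inverseʳ : ∀ {x} → 0# < x → x * x ⁻¹ ≈ 1#
  inverseʳ (_ , 0≉x) = ⁻¹-inverseʳ (0≉x ∘ sym)

  ⁻¹-pos : ∀ {x} → 0# < x → 0# < x ⁻¹
  ⁻¹-pos {x} 0<x =
    *-cancelʳ-< x (<⇒≤ 0<x) (<-respˡ (sym (zeroˡ x)) (<-respʳ (trans (sym (inverseʳ 0<x)) (*-comm _ _)) 0<1))

  ⁻¹-unique : ∀ {x y} → 0# < x → y * x ≈ 1# → y ≈ x ⁻¹
  ⁻¹-unique {x} 0<x yx≈1 = *-cancelʳ-≈ x 0<x (trans yx≈1 (trans (sym (inverseʳ 0<x)) (*-comm _ _)))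

  /-*-cancel : ∀ {x y} → 0# < y → x / y * y ≈ x
  /-*-cancel {x} {y} 0<y = trans (trans (*-assoc _ _ _) (*-congˡ (trans (*-comm _ _) (inverseʳ 0<y)))) (*-identityʳ x)

  ≤-/ : ∀ {x y z} → 0# < z → x * z ≤ y → x ≤ y / z
  ≤-/ {z = z} 0<z xz≤y = *-cancelʳ-≤ z 0<z (≤-respʳ-≈ (sym (/-*-cancel 0<z)) xz≤y)

  /-≤ : ∀ {x y z} → 0# < z → x ≤ y * z → x / z ≤ y
  /-≤ {z = z} 0<z x≤yz = *-cancelʳ-≤ z 0<z (≤-respˡ-≈ (sym (/-*-cancel 0<z)) x≤yz)

  /-pos : ∀ {x y} → 0# < x → 0# < y → 0# < x / y
  /-pos 0<x 0<y = *-pos 0<x (⁻¹-pos 0<y)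

  -- Absolute values

  private
    module MaxProperties = Max totalOrder

  ∣∣-≤ : ∀ {x c} → x ≤ c → - x ≤ c → ∣ x ∣ ≤ c
  ∣∣-≤ = MaxProperties.⊔-lub

  x≤∣x∣ : ∀ x → x ≤ ∣ x ∣
  x≤∣x∣ x = MaxProperties.x≤x⊔y x (- x)

  -x≤∣x∣ : ∀ x → - x ≤ ∣ x ∣
  -x≤∣x∣ x = MaxProperties.x≤y⊔x x (- x)

  0≤∣x∣ : ∀ x → 0# ≤ ∣ x ∣
  0≤∣x∣ x with total 0# x
  ... | inj₁ 0≤x = ≤-trans 0≤x (x≤∣x∣ x)
  ... | inj₂ x≤0 = ≤-trans (≤-cancel x≤0 (solve 1 (λ x → :- x :+ x := (con (+ 0)) :+ (con (+ 0))) refl x)) (-x≤∣x∣ x)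

  ∣∣-≈ : ∀ x → ∣ x ∣ ≈ x ⊎ ∣ x ∣ ≈ - x
  ∣∣-≈ x = MaxProperties.⊔-sel x (- x)

  ∣∣-< : ∀ {x c} → x < c → - x < c → ∣ x ∣ < c
  ∣∣-< {x} x<c -x<c with ∣∣-≈ x
  ... | inj₁ eq = <-respˡ (sym eq) x<c
  ... | inj₂ eq = <-respˡ (sym eq) -x<c

  ∣∣-cong : ∀ {x y} → x ≈ y → ∣ x ∣ ≈ ∣ y ∣
  ∣∣-cong x≈y = MaxProperties.⊔-cong x≈y (-‿cong x≈y)

  -- Twice `p * q - x * y`, and likewise twice `p * q + x * y`, is a sum of two products of the
  -- nonnegative numbers `p ± x` and `q ± y`; this avoids distinguishing signs.
  ∣∣-* : ∀ x y → ∣ x * y ∣ ≤ ∣ x ∣ * ∣ y ∣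
  ∣∣-* x y = ∣∣-≤ {x * y} product negative
    where
    p = ∣ x ∣
    q = ∣ y ∣
    0≤p-x : 0# ≤ p - x
    0≤p-x = difference-nonNeg (x≤∣x∣ x)
    0≤p+x : 0# ≤ p - - x
    0≤p+x = difference-nonNeg (-x≤∣x∣ x)
    0≤q-y : 0# ≤ q - y
    0≤q-y = difference-nonNeg (x≤∣x∣ y)
    0≤q+y : 0# ≤ q - - y
    0≤q+y = difference-nonNeg (-x≤∣x∣ y)
    halve : ∀ {z} → 0# ≤ z + z → 0# ≤ z
    halve {z} 0≤z+z = ≮⇒≥ λ z<0 → <⇒≱ (<-respʳ (+-identityˡ 0#) (<⇒≤ z<0 ⊹< z<0)) 0≤z+z
    product : x * y ≤ p * q
    product = ≤-cancel (halve (≤-respʳ-≈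
        (solve 4 (λ p x q y →
            (p :- x) :* (q :- :- y) :+ (p :- :- x) :* (q :- y) :=
            (p :* q :- x :* y) :+ (p :* q :- x :* y)) refl
          p x q y)
      (+-nonNeg (*-nonNeg 0≤p-x 0≤q+y) (*-nonNeg 0≤p+x 0≤q-y))))
          (solve 4 (λ p q x y →
              p :* q :+ (con (+ 0)) :=
              x :* y :+ (p :* q :- x :* y)) refl
            p q x y)
    negative : - (x * y) ≤ p * q
    negative = ≤-cancel (halve (≤-respʳ-≈
        (solve 4 (λ p x q y →
            (p :- x) :* (q :- y) :+ (p :- :- x) :* (q :- :- y) :=
            (p :* q :+ x :* y) :+ (p :* q :+ x :* y)) refl
          p x q y)
      (+-nonNeg (*-nonNeg 0≤p-x 0≤q-y) (*-nonNeg 0≤p+x 0≤q+y))))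
          (solve 4 (λ p q x y →
              p :* q :+ (con (+ 0)) :=
              :- (x :* y) :+ (p :* q :+ x :* y)) refl
            p q x y)

  ∣∣-+ : ∀ x y → ∣ x + y ∣ ≤ ∣ x ∣ + ∣ y ∣
  ∣∣-+ x y = ∣∣-≤ {x + y} (x≤∣x∣ x ⊹ x≤∣x∣ y) (≤-respˡ-≈ (-‿+-comm x y) (-x≤∣x∣ x ⊹ -x≤∣x∣ y))

  -- Natural numbers and integers as reals; the archimedean property

  fromℕ-natural : ∀ n → fromℕ n ≈ natural n
  fromℕ-natural n = Natural.×ᵤ≈× n 1#

  fromℤ-integer : ∀ i → fromℤ i ≈ integer i
  fromℤ-integer (+ n)    = fromℕ-natural n
  fromℤ-integer -[1+ n ] = -‿cong (fromℕ-natural (suc n))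

  fromℤ-+ : ∀ i j → fromℤ (i ℤ.+ j) ≈ fromℤ i + fromℤ j
  fromℤ-+ i j =
    trans (fromℤ-integer (i ℤ.+ j)) (trans (integer-+ i j) (sym (+-cong (fromℤ-integer i) (fromℤ-integer j))))

  fromℤ-* : ∀ i j → fromℤ (i ℤ.* j) ≈ fromℤ i * fromℤ j
  fromℤ-* i j =
    trans (fromℤ-integer (i ℤ.* j)) (trans (integer-* i j) (sym (*-cong (fromℤ-integer i) (fromℤ-integer j))))

  fromℤ-neg : ∀ i → fromℤ (ℤ.- i) ≈ - fromℤ i
  fromℤ-neg i = trans (fromℤ-integer (ℤ.- i)) (trans (integer-neg i) (-‿cong (sym (fromℤ-integer i))))

  open Mult semiring using (×1-homo-*)

  fromℕ-* : ∀ m n → fromℕ (m ℕ.* n) ≈ fromℕ m * fromℕ n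
  fromℕ-* = ×1-homo-*

  fromℕ-1 : fromℕ 1 ≈ 1#
  fromℕ-1 = +-identityʳ 1#

  0≤fromℕ : ∀ n → 0# ≤ fromℕ n
  0≤fromℕ zero    = ≤-refl
  0≤fromℕ (suc n) = +-nonNeg 0≤1 (0≤fromℕ n)

  fromℕ-mono-≤ : ∀ {m n} → m ℕ.≤ n → fromℕ m ≤ fromℕ n
  fromℕ-mono-≤ {n = n} ℕ.z≤n = 0≤fromℕ n
  fromℕ-mono-≤ (ℕ.s≤s m≤n) = +-monoʳ-≤ 1# (fromℕ-mono-≤ m≤n)

  1≤fromℕ : ∀ n → 1# ≤ fromℕ (suc n)
  1≤fromℕ n = x≤x+y 1# (0≤fromℕ n)

  0<fromℕ : ∀ n .{{_ : NonZero n}} → 0# < fromℕ n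
  0<fromℕ (suc n) = <-≤-trans 0<1 (1≤fromℕ n)

  fromℤ-pos : ∀ i → 0# < fromℤ i → 1# ≤ fromℤ i
  fromℤ-pos (+ zero)  0<0 = ⊥-elim (<-irrefl 0<0)
  fromℤ-pos (+ suc n) _   = 1≤fromℕ n
  fromℤ-pos -[1+ n ]  0<i = ⊥-elim (<⇒≱ 0<i (≤-cancel (0≤fromℕ (suc n))
      (solve 1 (λ z0 →
          (con (+ 0)) :+ (con (+ 0)) :=
          :- z0 :+ z0) refl
        (fromℕ (suc n)))))

  -- If the naturals had a supremum `s`, then `s - 1#` would bound them as well, because `n + 1` is
  -- a natural too.
  archimedean : ∀ x → ∃[ n ] x < fromℕ n
  archimedean x with lem {P = ∃[ n ] x < fromℕ n}
  ... | yes found = found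
  ... | no  none  = ⊥-elim (<⇒≱ (x<x+y (s - 1#) 0<1) (≤-respˡ-≈
      (solve 1 (λ s →
          s :=
          s :- (con (+ 1)) :+ (con (+ 1))) refl
        s) (least bounded)))
    where
    Naturals : Carrier → Set
    Naturals y = ∃[ n ] y ≈ fromℕ n
    supremum : ∃ (IsSupremum Naturals)
    supremum = complete Naturals (0# , 0 , refl) (x , λ { (n , y≈n) → ≮⇒≥ λ x<y → none (n , <-respʳ y≈n x<y) })
    s = proj₁ supremum
    least : ∀ {v} → UpperBound Naturals v → s ≤ v
    least = proj₂ (proj₂ supremum)
    bounded : UpperBound Naturals (s - 1#)
    bounded {y} (n , y≈n) = ≤-cancel (proj₁ (proj₂ supremum) (suc n , refl))
      (trans
          (solve 2 (λ z0 s →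
              s :- (con (+ 1)) :+ ((con (+ 1)) :+ z0) :=
              z0 :+ s) refl
            (fromℕ n) s) (+-congʳ (sym y≈n)))

  -- Natural powers and halving

  ^-nonNeg : ∀ {x} → 0# ≤ x → ∀ n → 0# ≤ x ^ n
  ^-nonNeg 0≤x zero    = 0≤1
  ^-nonNeg 0≤x (suc n) = *-nonNeg 0≤x (^-nonNeg 0≤x n)

  ^-pos : ∀ {x} → 0# < x → ∀ n → 0# < x ^ n
  ^-pos 0<x zero    = 0<1
  ^-pos 0<x (suc n) = *-pos 0<x (^-pos 0<x n)

  ^-monoˡ-≤ : ∀ {x y} → 0# ≤ x → x ≤ y → ∀ n → x ^ n ≤ y ^ n
  ^-monoˡ-≤ 0≤x x≤y zero    = ≤-refl
  ^-monoˡ-≤ 0≤x x≤y (suc n) = *-mono-≤ 0≤x x≤y (^-nonNeg 0≤x n) (^-monoˡ-≤ 0≤x x≤y n)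

  ^-≤1 : ∀ {x} → 0# ≤ x → x ≤ 1# → ∀ n → x ^ n ≤ 1#
  ^-≤1 0≤x x≤1 zero    = ≤-refl
  ^-≤1 0≤x x≤1 (suc n) = ≤-trans (*-mono-≤ 0≤x x≤1 (^-nonNeg 0≤x n) (^-≤1 0≤x x≤1 n)) (≤-reflexive (*-identityˡ 1#))

  1≤^ : ∀ {x} → 1# ≤ x → ∀ n → 1# ≤ x ^ n
  1≤^ 1≤x zero    = ≤-refl
  1≤^ 1≤x (suc n) = ≤-trans (≤-reflexive (sym (*-identityˡ 1#))) (*-mono-≤ 0≤1 1≤x 0≤1 (1≤^ 1≤x n))

  1<^ : ∀ {x} → 1# < x → ∀ n → 1# < x ^ suc n
  1<^ {x} 1<x n =
    <-≤-trans 1<x (≤-trans (≤-reflexive (sym (*-identityʳ x))) (*-monoʳ-≤ x (<⇒≤ (<-trans 0<1 1<x)) (1≤^ (<⇒≤ 1<x) n)))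

  open Exp commutativeSemiring using (^-homo-*; ^-distrib-*; ^-congˡ)

  ½ : Carrier
  ½ = (1# + 1#) ⁻¹

  0<2 : 0# < 1# + 1#
  0<2 = +-pos 0≤1 0<1

  0<½ : 0# < ½
  0<½ = ⁻¹-pos 0<2

  half-sum : ∀ x → x * ½ + x * ½ ≈ x
  half-sum x = begin-equality
    x * ½ + x * ½         ≈⟨ (solve 2 (λ x ½ → x :* ½ :+ x :* ½ := x :* (((con (+ 1)) :+ (con (+ 1))) :* ½)) refl x ½) ⟩
    x * ((1# + 1#) * ½)   ≈⟨ *-congˡ (inverseʳ 0<2) ⟩
    x * 1#                ≈⟨ *-identityʳ x ⟩
    x                     ∎

  half-pos : ∀ {x} → 0# < x → 0# < x * ½
  half-pos 0<x = *-pos 0<x 0<½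

  ½<1 : ½ < 1#
  ½<1 = <-cancel 0<½ (trans (+-identityʳ 1#) (trans (sym (half-sum 1#)) (+-cong (*-identityˡ ½) (*-identityˡ ½))))

  ∣-∣<⇒<ʳ : ∀ {x y ε} → ∣ x - y ∣ < ε → x < y + ε
  ∣-∣<⇒<ʳ {x} {y} {ε} close = <-cancel (≤-<-trans (x≤∣x∣ (x - y)) close)
      (solve 3 (λ y ε x →
          (y :+ ε) :+ (x :- y) :=
          x :+ ε) refl
        y ε x)

  ∣-∣<⇒<ˡ : ∀ {x y ε} → ∣ x - y ∣ < ε → y < x + ε
  ∣-∣<⇒<ˡ {x} {y} {ε} close = <-cancel (≤-<-trans (-x≤∣x∣ (x - y)) close)
      (solve 3 (λ x ε y →
          (x :+ ε) :+ :- (x :- y) :=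
          y :+ ε) refl
        x ε y)

  ∣-∣<-intro : ∀ {x y ε} → x < y + ε → y < x + ε → ∣ x - y ∣ < ε
  ∣-∣<-intro {x} {y} {ε} x<y+ε y<x+ε = ∣∣-< {x - y}
    (<-cancel x<y+ε (solve 3 (λ ε x y → ε :+ x := (x :- y) :+ (y :+ ε)) refl ε x y))
    (<-cancel y<x+ε (solve 3 (λ ε y x → ε :+ y := :- (x :- y) :+ (x :+ ε)) refl ε y x))

  -- Limits of sequences

  lim-elim : ∀ {f l} → f ConvergesTo l → ∀ {ε} → 0# < ε → ∃[ K ] ∀ n → K ℕ.≤ n → f n < l + ε × l < f n + ε
  lim-elim {f} {l} f→l {ε} 0<ε with f→l ε 0<ε
  ... | K , close = K , λ n K≤n → ∣-∣<⇒<ʳ {f n} {l} {ε} (close n K≤n) , ∣-∣<⇒<ˡ {f n} {l} {ε} (close n K≤n)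

  lim-intro : ∀ {f l} → (∀ ε → 0# < ε → ∃[ K ] ∀ n → K ℕ.≤ n → f n < l + ε × l < f n + ε) → f ConvergesTo l
  lim-intro {f} {l} near ε 0<ε with near ε 0<ε
  ... | K , bounds = K , λ n K≤n → ∣-∣<-intro {f n} {l} {ε} (proj₁ (bounds n K≤n)) (proj₂ (bounds n K≤n))

  lim-const : ∀ c → (λ _ → c) ConvergesTo c
  lim-const c = lim-intro λ ε 0<ε → 0 , λ _ _ → x<x+y c 0<ε , x<x+y c 0<ε

  lim-cong : ∀ {f g l} → (∀ n → f n ≈ g n) → f ConvergesTo l → g ConvergesTo l
  lim-cong {f} {g} {l} f≈g f→l = lim-intro λ ε 0<ε → bounds (lim-elim f→l 0<ε)
    where
    bounds : ∀ {ε} → (∃[ K ] ∀ n → K ℕ.≤ n → f n < l + ε × l < f n + ε) → ∃[ K ] ∀ n → K ℕ.≤ n →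
      g n < l + ε × l < g n + ε
    bounds (K , near) =
      K , λ n K≤n → <-respˡ (f≈g n) (proj₁ (near n K≤n)) , <-respʳ (+-congʳ (f≈g n)) (proj₂ (near n K≤n))

  lim-≤ : ∀ {f g a b} K → (∀ n → K ℕ.≤ n → f n ≤ g n) → f ConvergesTo a → g ConvergesTo b → a ≤ b
  lim-≤ {f} {g} {a} {b} K f≤g f→a g→b = ≮⇒≥ λ b<a →
    let 0<h = half-pos (difference-pos b<a) in contradiction 0<h (lim-elim f→a 0<h) (lim-elim g→b 0<h)
    where
    h = (a - b) * ½
    contradiction : 0# < h → (∃[ K ] ∀ n → K ℕ.≤ n → f n < a + h × a < f n + h) →
      (∃[ K ] ∀ n → K ℕ.≤ n → g n < b + h × b < g n + h) → ⊥
    contradiction 0<h (K₁ , near₁) (K₂ , near₂) = <-irrefl {a + b} (<-cancel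
      (f≤g n (ℕ.m≤m⊔n K _) ⊹ <⇒≤ (proj₁ (near₂ n (ℕ.≤-trans (ℕ.m≤n⊔m K₁ K₂) (ℕ.m≤n⊔m K _)))) ⊹< proj₂
        (near₁ n (ℕ.≤-trans (ℕ.m≤m⊔n K₁ K₂) (ℕ.m≤n⊔m K _))))
      (begin-equality
        a + b + (f n + g n + a)                       ≈⟨
            (solve 4 (λ z0 z1 a b →
                a :+ b :+ (z0 :+ z1 :+ a) :=
                b :+ (b :+ (a :- b)) :+ (z0 :+ z1 :+ a)) refl
              (f n) (g n) a b) ⟩
        b + (b + (a - b)) + (f n + g n + a)           ≈⟨ +-congʳ (+-congˡ (+-congˡ (half-sum (a - b)))) ⟨
        b + (b + (h + h)) + (f n + g n + a)           ≈⟨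
            (solve 5 (λ z0 z1 b h a →
                b :+ (b :+ (h :+ h)) :+ (z0 :+ z1 :+ a) :=
                a :+ b :+ (z1 :+ (b :+ h) :+ (z0 :+ h))) refl
              (f n) (g n) b h a) ⟩
        a + b + (g n + (b + h) + (f n + h))           ∎))
      where
      n = K ℕ.⊔ (K₁ ℕ.⊔ K₂)

  lim-unique : ∀ {f a b} → f ConvergesTo a → f ConvergesTo b → a ≈ b
  lim-unique f→a f→b = antisym (lim-≤ 0 (λ _ _ → ≤-refl) f→a f→b) (lim-≤ 0 (λ _ _ → ≤-refl) f→b f→a)

  lim-neg : ∀ {f a} → f ConvergesTo a → (λ n → - f n) ConvergesTo (- a)
  lim-neg {f} {a} f→a = lim-intro λ ε 0<ε → bounds ε (lim-elim f→a 0<ε)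
    where
    bounds : ∀ ε → (∃[ K ] ∀ n → K ℕ.≤ n → f n < a + ε × a < f n + ε) → ∃[ K ] ∀ n → K ℕ.≤ n →
      - f n < - a + ε × - a < - f n + ε
    bounds ε (K , near) = K , λ n K≤n →
      <-cancel (proj₂ (near n K≤n)) (solve 3 (λ z0 a ε → :- a :+ ε :+ a := :- z0 :+ (z0 :+ ε)) refl (f n) a ε) ,
      <-cancel (proj₁ (near n K≤n)) (solve 3 (λ z0 ε a → :- z0 :+ ε :+ z0 := :- a :+ (a :+ ε)) refl (f n) ε a)

  lim-+ : ∀ {f g a b} → f ConvergesTo a → g ConvergesTo b → (λ n → f n + g n) ConvergesTo (a + b)
  lim-+ {f} {g} {a} {b} f→a g→b =
    lim-intro λ ε 0<ε → bounds ε (lim-elim f→a (half-pos 0<ε)) (lim-elim g→b (half-pos 0<ε))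
    where
    split : ∀ ε x y → (x + ε * ½) + (y + ε * ½) ≈ x + y + ε
    split ε x y = trans
        (solve 3 (λ z0 x y →
            (x :+ z0) :+ (y :+ z0) :=
            x :+ y :+ (z0 :+ z0)) refl
          (ε * ½) x y) (+-congˡ (half-sum ε))
    bounds : ∀ ε → (∃[ K ] ∀ n → K ℕ.≤ n → f n < a + ε * ½ × a < f n + ε * ½) →
      (∃[ K ] ∀ n → K ℕ.≤ n → g n < b + ε * ½ × b < g n + ε * ½) →
      ∃[ K ] ∀ n → K ℕ.≤ n → f n + g n < a + b + ε × a + b < f n + g n + ε
    bounds ε (K₁ , near₁) (K₂ , near₂) = K₁ ℕ.⊔ K₂ , λ n K≤n →
      let (up₁ , low₁) = near₁ n (ℕ.≤-trans (ℕ.m≤m⊔n K₁ K₂) K≤n)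
          (up₂ , low₂) = near₂ n (ℕ.≤-trans (ℕ.m≤n⊔m K₁ K₂) K≤n)
      in <-respʳ (split ε a b) (<⇒≤ up₁ ⊹< up₂) , <-respʳ (split ε (f n) (g n)) (<⇒≤ low₁ ⊹< low₂)

  lim-* : ∀ {f g a b} → f ConvergesTo a → g ConvergesTo b → (λ n → f n * g n) ConvergesTo (a * b)
  lim-* {f} {g} {a} {b} f→a g→b ε 0<ε = bound (f→a η 0<η) (g→b η 0<η)
    where
    p = ∣ a ∣
    q = ∣ b ∣
    d = ε + (1# + p + q)
    1≤r : 1# ≤ 1# + p + q
    1≤r = ≤-trans (x≤x+y 1# (0≤∣x∣ a)) (x≤x+y (1# + p) (0≤∣x∣ b))
    0<d : 0# < d
    0<d = +-pos (<⇒≤ 0<ε) (<-≤-trans 0<1 1≤r)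
    -- The two summands of `d` serve two purposes: `d ≥ ε` gives `η ≤ 1#`, so that the quadratic
    -- error is at most `η`, and `d > 1# + p + q` makes the total error `η * (1# + p + q)` less than
    -- `ε`.
    η = ε / d
    0<η : 0# < η
    0<η = /-pos 0<ε 0<d
    η≤1 : η ≤ 1#
    η≤1 = /-≤ 0<d (≤-trans (x≤x+y ε (≤-trans 0≤1 1≤r)) (≤-reflexive (sym (*-identityˡ d))))
    small : η * (1# + p + q) < ε
    small = <-cancel (*-pos 0<η 0<ε)
      (trans (+-identityʳ ε) (trans (sym (/-*-cancel 0<d))
          (solve 4 (λ η ε p q →
              η :* (ε :+ ((con (+ 1)) :+ p :+ q)) :=
              η :* ((con (+ 1)) :+ p :+ q) :+ η :* ε) refl
            η ε p q)))
    product-bound : ∀ u v → ∣ u ∣ ≤ η → ∣ v ∣ ≤ η → ∣ u * v + a * v + u * b ∣ < ε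
    product-bound u v ∣u∣≤η ∣v∣≤η =
      ≤-<-trans (≤-trans (∣∣-+ (u * v + a * v) (u * b))
        (≤-trans (∣∣-+ (u * v) (a * v)) (∣∣-* u v ⊹ ∣∣-* a v) ⊹ ∣∣-* u b))
      (≤-<-trans (*-mono-≤ (0≤∣x∣ u) ∣u∣≤η (0≤∣x∣ v) (≤-trans ∣v∣≤η η≤1) ⊹ *-monoʳ-≤ p
        (0≤∣x∣ a) ∣v∣≤η ⊹ *-monoˡ-≤ q (0≤∣x∣ b) ∣u∣≤η)
        (<-respˡ
            (solve 3 (λ η p q →
                η :* ((con (+ 1)) :+ p :+ q) :=
                η :* (con (+ 1)) :+ p :* η :+ η :* q) refl
              η p q) small))
    bound : (∃[ K ] ∀ n → K ℕ.≤ n → ∣ f n - a ∣ < η) → (∃[ K ] ∀ n → K ℕ.≤ n → ∣ g n - b ∣ < η) → ∃[ K ] ∀ n →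
      K ℕ.≤ n → ∣ f n * g n - a * b ∣ < ε
    bound (K₁ , close₁) (K₂ , close₂) = K₁ ℕ.⊔ K₂ , λ n K≤n → <-respˡ
      (∣∣-cong
          (solve 4 (λ z0 z1 a b →
              (z0 :- a) :* (z1 :- b) :+ a :* (z1 :- b) :+ (z0 :- a) :* b :=
              z0 :* z1 :- a :* b) refl
            (f n) (g n) a b))
      (product-bound (f n - a) (g n - b) (<⇒≤ (close₁ n (ℕ.≤-trans (ℕ.m≤m⊔n K₁ K₂) K≤n)))
        (<⇒≤ (close₂ n (ℕ.≤-trans (ℕ.m≤n⊔m K₁ K₂) K≤n))))

  monotone-≤ : ∀ {f : ℕ → Carrier} → (∀ n → f n ≤ f (suc n)) → ∀ {m n} → m ℕ.≤ n → f m ≤ f n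
  monotone-≤ {f} step m≤n = go (ℕ.≤⇒≤′ m≤n)
    where
    go : ∀ {m n} → m ℕ.≤′ n → f m ≤ f n
    go (ℕ.≤′-reflexive ≡.refl) = ≤-refl
    go (ℕ.≤′-step m≤′n)        = ≤-trans (go m≤′n) (step _)

  monotone-convergence : ∀ {f B} → (∀ n → f n ≤ f (suc n)) → (∀ n → f n ≤ B) → ∃[ l ] f ConvergesTo l
  monotone-convergence {f} {B} step bounded = s , converges
    where
    Values : Carrier → Set
    Values y = ∃[ n ] y ≈ f n
    supremum : ∃ (IsSupremum Values)
    supremum = complete Values (f 0 , 0 , refl) (B , λ { (n , y≈fn) → ≤-respˡ-≈ (sym y≈fn) (bounded n) })
    s = proj₁ supremum
    f≤s : ∀ n → f n ≤ s
    f≤s n = proj₁ (proj₂ supremum) (n , refl)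
    converges : f ConvergesTo s
    converges = lim-intro bounds
      where
      bounds : ∀ ε → 0# < ε → ∃[ K ] ∀ n → K ℕ.≤ n → f n < s + ε × s < f n + ε
      bounds ε 0<ε with lem {P = ∃[ n ] s - ε < f n}
      ... | yes (K , near) = K , λ n K≤n →
        ≤-<-trans (f≤s n) (x<x+y s 0<ε) ,
        <-cancel (<-≤-trans near (monotone-≤ step K≤n))
            (solve 3 (λ z0 ε s →
                z0 :+ ε :+ (s :- ε) :=
                s :+ z0) refl
              (f n) ε s)
      ... | no none = ⊥-elim (<⇒≱ (<-cancel 0<ε (solve 2 (λ s ε → s :+ (con (+ 0)) := s :- ε :+ ε) refl s ε))
        (proj₂ (proj₂ supremum) λ { (n , y≈fn) → ≤-respˡ-≈ (sym y≈fn) (≮⇒≥ λ near → none (n , near)) }))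

  -- Partial sums

  partialSum-cong : ∀ {f g} → (∀ k → f k ≈ g k) → ∀ n → partialSum f n ≈ partialSum g n
  partialSum-cong f≈g zero    = refl
  partialSum-cong f≈g (suc n) = +-cong (f≈g 0) (partialSum-cong (f≈g ∘ suc) n)

  partialSum-mono : ∀ {f g} → (∀ k → f k ≤ g k) → ∀ n → partialSum f n ≤ partialSum g n
  partialSum-mono f≤g zero    = ≤-refl
  partialSum-mono f≤g (suc n) = f≤g 0 ⊹ partialSum-mono (f≤g ∘ suc) n

  partialSum-last : ∀ f n → partialSum f (suc n) ≈ partialSum f n + f n
  partialSum-last f zero    = +-comm _ _
  partialSum-last f (suc n) = trans (+-congˡ (partialSum-last (f ∘ suc) n)) (sym (+-assoc _ _ _))

  partialSum-+ : ∀ f g n → partialSum (λ k → f k + g k) n ≈ partialSum f n + partialSum g n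
  partialSum-+ f g zero    = sym (+-identityˡ 0#)
  partialSum-+ f g (suc n) = trans (+-congˡ (partialSum-+ (f ∘ suc) (g ∘ suc) n))

        (solve 4 (λ z0 z1 z2 z3 →
            z0 :+ z1 :+ (z2 :+ z3) :=
            z0 :+ z2 :+ (z1 :+ z3)) refl
          (f 0) (g 0) (partialSum (f ∘ suc) n) (partialSum (g ∘ suc) n))

  partialSum-* : ∀ c f n → partialSum (λ k → c * f k) n ≈ c * partialSum f n
  partialSum-* c f zero    = sym (zeroʳ c)
  partialSum-* c f (suc n) = trans (+-congˡ (partialSum-* c (f ∘ suc) n)) (sym (distribˡ c _ _))

  partialSum-nonNeg : ∀ {f} → (∀ k → 0# ≤ f k) → ∀ n → 0# ≤ partialSum f n
  partialSum-nonNeg 0≤f zero    = ≤-refl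
  partialSum-nonNeg 0≤f (suc n) = +-nonNeg (0≤f 0) (partialSum-nonNeg (0≤f ∘ suc) n)

  partialSum-step : ∀ {f} → (∀ k → 0# ≤ f k) → ∀ n → partialSum f n ≤ partialSum f (suc n)
  partialSum-step {f} 0≤f n = ≤-respʳ-≈ (sym (partialSum-last f n)) (x≤x+y _ (0≤f n))

  partialSum-mono-index : ∀ {f} → (∀ k → 0# ≤ f k) → ∀ {m n} → m ℕ.≤ n → partialSum f m ≤ partialSum f n
  partialSum-mono-index 0≤f = monotone-≤ (partialSum-step 0≤f)

  -- The terms of `f + g` and of `g` are nonnegative with bounded sums, so both series converge
  -- monotonically, and `f` is their difference.
  absolutely-convergent : ∀ {f g B} → (∀ k → ∣ f k ∣ ≤ g k) → (∀ n → partialSum g n ≤ B) →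
    ∃[ l ] partialSum f ConvergesTo l
  absolutely-convergent {f} {g} {B} ∣f∣≤g bounded = b - a , lim-cong
    (λ n → trans (+-congʳ (partialSum-+ f g n))
        (solve 2 (λ z0 z1 →
            z0 :+ z1 :- z1 :=
            z0) refl
          (partialSum f n) (partialSum g n)))
    (lim-+ (proj₂ Σf+g-converges) (lim-neg (proj₂ Σg-converges)))
    where
    0≤f+g : ∀ k → 0# ≤ f k + g k
    0≤f+g k = ≤-cancel (≤-trans (-x≤∣x∣ (f k)) (∣f∣≤g k))
        (solve 2 (λ z0 z1 →
            z0 :+ z1 :+ :- z0 :=
            (con (+ 0)) :+ z1) refl
          (f k) (g k))
    bounded′ : ∀ n → partialSum (λ k → f k + g k) n ≤ B + B
    bounded′ n = ≤-respˡ-≈ (sym (partialSum-+ f g n))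
      (≤-trans (partialSum-mono (λ k → ≤-trans (x≤∣x∣ (f k)) (∣f∣≤g k)) n) (bounded n) ⊹ bounded n)
    Σg-converges : ∃[ l ] partialSum g ConvergesTo l
    Σg-converges = monotone-convergence (partialSum-step {g} λ k → ≤-trans (0≤∣x∣ (f k)) (∣f∣≤g k)) bounded
    Σf+g-converges : ∃[ l ] partialSum (λ k → f k + g k) ConvergesTo l
    Σf+g-converges = monotone-convergence (partialSum-step {λ k → f k + g k} 0≤f+g) bounded′
    a = proj₁ Σg-converges
    b = proj₁ Σf+g-converges

  -- Cauchy products

  -- The sum of `a i * b (k - i)` over `i ≤ k`. Shifting `a` in the recursion avoids subtracting
  -- indices.
  convolution : (ℕ → Carrier) → (ℕ → Carrier) → ℕ → Carrier
  convolution a b zero    = a 0 * b 0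
  convolution a b (suc k) = a 0 * b (suc k) + convolution (a ∘ suc) b k

  -- The sum of the products a i * b j with i + j < n.
  triangleSum : (ℕ → Carrier) → (ℕ → Carrier) → ℕ → Carrier
  triangleSum a b zero    = 0#
  triangleSum a b (suc n) = a 0 * partialSum b (suc n) + triangleSum (a ∘ suc) b n

  triangleSum-last : ∀ a b n → triangleSum a b (suc n) ≈ triangleSum a b n + convolution a b n
  triangleSum-last a b zero    =
      (solve 2 (λ z0 z1 →
          z0 :* (z1 :+ (con (+ 0))) :+ (con (+ 0)) :=
          (con (+ 0)) :+ z0 :* z1) refl
        (a 0) (b 0))
  triangleSum-last a b (suc n) = trans (+-cong (*-congˡ (partialSum-last b (suc n))) (triangleSum-last (a ∘ suc) b n))

        (solve 5 (λ z0 z1 z2 z3 z4 →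
            z0 :* (z1 :+ z2) :+ (z3 :+ z4) :=
            z0 :* z1 :+ z3 :+ (z0 :* z2 :+ z4)) refl
          (a 0) (partialSum b (suc n)) (b (suc n)) (triangleSum (a ∘ suc) b n) (convolution (a ∘ suc) b n))

  triangleSum-convolution : ∀ a b n → triangleSum a b n ≈ partialSum (convolution a b) n
  triangleSum-convolution a b zero    = refl
  triangleSum-convolution a b (suc n) = trans (triangleSum-last a b n)
    (trans (+-congʳ (triangleSum-convolution a b n)) (sym (partialSum-last (convolution a b) n)))

  tail-bound : ∀ {b b̅} → (∀ k → ∣ b k ∣ ≤ b̅ k) → ∀ {m n} → m ℕ.≤′ n →
    ∣ partialSum b n - partialSum b m ∣ ≤ partialSum b̅ n - partialSum b̅ m
  tail-bound {b} {b̅} ∣b∣≤b̅ {m} (ℕ.≤′-reflexive ≡.refl) = ≤-trans (≤-reflexive (∣∣-cong (-‿inverseʳ (partialSum b m))))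
    (≤-trans (∣∣-≤ {0#} ≤-refl (≤-reflexive -0#≈0#)) (≤-reflexive (sym (-‿inverseʳ (partialSum b̅ m)))))
  tail-bound {b} {b̅} ∣b∣≤b̅ {m} {suc n} (ℕ.≤′-step m≤′n) = begin
    ∣ partialSum b (suc n) - B ∣                  ≈⟨ ∣∣-cong (+-congʳ (partialSum-last b n)) ⟩
    ∣ partialSum b n + b n - B ∣                  ≈⟨ ∣∣-cong
        (solve 3 (λ z0 z1 B →
            z0 :+ z1 :- B :=
            z0 :- B :+ z1) refl
          (partialSum b n) (b n) B) ⟩
    ∣ partialSum b n - B + b n ∣                  ≤⟨ ∣∣-+ (partialSum b n - B) (b n) ⟩
    ∣ partialSum b n - B ∣ + ∣ b n ∣              ≤⟨ tail-bound ∣b∣≤b̅ m≤′n ⊹ ∣b∣≤b̅ n ⟩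
    partialSum b̅ n - B̅ + b̅ n                   ≈⟨
        (solve 3 (λ z0 z1 B̅ →
            z0 :- B̅ :+ z1 :=
            z0 :+ z1 :- B̅) refl
          (partialSum b̅ n) (b̅ n) B̅) ⟩
    partialSum b̅ n + b̅ n - B̅                   ≈⟨ +-congʳ (partialSum-last b̅ n) ⟨
    partialSum b̅ (suc n) - B̅                    ∎
    where
    B = partialSum b m
    B̅ = partialSum b̅ m

  -- The difference on the left is the sum of `a i * b j` over `i < n`, `j < M` with `i + j ≥ n`,
  -- and the one on the right is the same sum for the majorants. The induction splits off the row
  -- `i = 0`, whose part outside the triangle is a tail of the series of `b`.
  product-triangle-bound : ∀ {a a̅ b b̅} → (∀ k → ∣ a k ∣ ≤ a̅ k) → (∀ k → ∣ b k ∣ ≤ b̅ k) → ∀ {n M} → n ℕ.≤ M →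
    ∣ partialSum a n * partialSum b M - triangleSum a b n ∣ ≤ partialSum a̅ n * partialSum b̅ M - triangleSum a̅ b̅ n
  product-triangle-bound {a} {a̅} {b} {b̅} ∣a∣≤a̅ ∣b∣≤b̅ {zero} {M} _ =
    ≤-trans (≤-reflexive (∣∣-cong
        (solve 1 (λ z0 →
            (con (+ 0)) :* z0 :- (con (+ 0)) :=
            (con (+ 0))) refl
          (partialSum b M))))
    (≤-trans (∣∣-≤ {0#} ≤-refl (≤-reflexive -0#≈0#)) (≤-reflexive
        (solve 1 (λ z0 →
            (con (+ 0)) :=
            (con (+ 0)) :* z0 :- (con (+ 0))) refl
          (partialSum b̅ M))))
  product-triangle-bound {a} {a̅} {b} {b̅} ∣a∣≤a̅ ∣b∣≤b̅ {suc n} {M} n<M = begin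
    ∣ (a 0 + A) * B - (a 0 * b₁ + t) ∣            ≈⟨ ∣∣-cong
        (solve 5 (λ z0 A B b₁ t →
            (z0 :+ A) :* B :- (z0 :* b₁ :+ t) :=
            z0 :* (B :- b₁) :+ (A :* B :- t)) refl
          (a 0) A B b₁ t) ⟩
    ∣ a 0 * (B - b₁) + (A * B - t) ∣              ≤⟨ ∣∣-+ (a 0 * (B - b₁)) (A * B - t) ⟩
    ∣ a 0 * (B - b₁) ∣ + ∣ A * B - t ∣
      ≤⟨ ≤-trans (∣∣-* (a 0) (B - b₁)) (*-mono-≤ (0≤∣x∣ (a 0)) (∣a∣≤a̅ 0) (0≤∣x∣ (B - b₁))
        (tail-bound ∣b∣≤b̅ (ℕ.≤⇒≤′ n<M)))
                                                     ⊹ product-triangle-bound (∣a∣≤a̅ ∘ suc) ∣b∣≤b̅ (ℕ.<⇒≤ n<M) ⟩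
    a̅ 0 * (B̅ - b̅₁) + (A̅ * B̅ - t̅)              ≈⟨
        (solve 5 (λ z0 B̅ b̅₁ A̅ t̅ →
            z0 :* (B̅ :- b̅₁) :+ (A̅ :* B̅ :- t̅) :=
            (z0 :+ A̅) :* B̅ :- (z0 :* b̅₁ :+ t̅)) refl
          (a̅ 0) B̅ b̅₁ A̅ t̅) ⟩
    (a̅ 0 + A̅) * B̅ - (a̅ 0 * b̅₁ + t̅)            ∎
    where
    A = partialSum (a ∘ suc) n
    A̅ = partialSum (a̅ ∘ suc) n
    B = partialSum b M
    B̅ = partialSum b̅ M
    b₁ = partialSum b (suc n)
    b̅₁ = partialSum b̅ (suc n)
    t = triangleSum (a ∘ suc) b n
    t̅ = triangleSum (a̅ ∘ suc) b̅ n

  -- The rectangle `i < n`, `j < M` lies inside the triangle `i + j < n + M`, and the remaining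
  -- terms are nonnegative.
  product-≤-triangle : ∀ {a b} → (∀ k → 0# ≤ a k) → (∀ k → 0# ≤ b k) → ∀ n M →
    partialSum a n * partialSum b M ≤ triangleSum a b (n ℕ.+ M)
  product-≤-triangle {a} {b} 0≤a 0≤b zero M = ≤-respˡ-≈ (sym (zeroˡ _))
    (≤-respʳ-≈ (sym (triangleSum-convolution a b M)) (partialSum-nonNeg (convolution-nonNeg 0≤a) M))
    where
    convolution-nonNeg : ∀ {a} → (∀ k → 0# ≤ a k) → ∀ k → 0# ≤ convolution a b k
    convolution-nonNeg 0≤a zero    = *-nonNeg (0≤a 0) (0≤b 0)
    convolution-nonNeg 0≤a (suc k) = +-nonNeg (*-nonNeg (0≤a 0) (0≤b (suc k))) (convolution-nonNeg (0≤a ∘ suc) k)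
  product-≤-triangle {a} {b} 0≤a 0≤b (suc n) M = ≤-respˡ-≈ (sym (distribʳ _ _ _))
    (*-monoʳ-≤ (a 0) (0≤a 0) (partialSum-mono-index 0≤b (ℕ.m≤n+m M (suc n))) ⊹ product-≤-triangle (0≤a ∘ suc) 0≤b n M)

  derivative : (ℕ → Carrier) → ℕ → Carrier
  derivative a k = fromℕ (suc k) * a (suc k)

  convolution-cong : ∀ {a a′ b b′} → (∀ k → a k ≈ a′ k) → (∀ k → b k ≈ b′ k) → ∀ k →
    convolution a b k ≈ convolution a′ b′ k
  convolution-cong a≈a′ b≈b′ zero    = *-cong (a≈a′ 0) (b≈b′ 0)
  convolution-cong a≈a′ b≈b′ (suc k) = +-cong (*-cong (a≈a′ 0) (b≈b′ (suc k))) (convolution-cong (a≈a′ ∘ suc) b≈b′ k)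

  convolution-+ : ∀ a a′ b k → convolution (λ i → a i + a′ i) b k ≈ convolution a b k + convolution a′ b k
  convolution-+ a a′ b zero    = distribʳ _ _ _
  convolution-+ a a′ b (suc k) = trans (+-congˡ (convolution-+ (a ∘ suc) (a′ ∘ suc) b k))

        (solve 5 (λ z0 z1 z2 z3 z4 →
            (z0 :+ z1) :* z2 :+ (z3 :+ z4) :=
            (z0 :* z2 :+ z3) :+ (z1 :* z2 :+ z4)) refl
          (a 0) (a′ 0) (b (suc k)) (convolution (a ∘ suc) b k) (convolution (a′ ∘ suc) b k))

  convolution-scaleˡ : ∀ c a b k → convolution (λ i → c * a i) b k ≈ c * convolution a b k
  convolution-scaleˡ c a b zero    = *-assoc _ _ _
  convolution-scaleˡ c a b (suc k) =
    trans (+-cong (*-assoc _ _ _) (convolution-scaleˡ c (a ∘ suc) b k)) (sym (distribˡ _ _ _))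

  convolution-scaleʳ : ∀ c a b k → convolution a (λ i → c * b i) k ≈ c * convolution a b k
  convolution-scaleʳ c a b zero    = (solve 3 (λ z0 z1 c → z0 :* (c :* z1) := c :* (z0 :* z1)) refl (a 0) (b 0) c)
  convolution-scaleʳ c a b (suc k) = trans (+-congˡ (convolution-scaleʳ c (a ∘ suc) b k))

        (solve 4 (λ z0 z1 z2 c →
            z0 :* (c :* z1) :+ c :* z2 :=
            c :* (z0 :* z1 :+ z2)) refl
          (a 0) (b (suc k)) (convolution (a ∘ suc) b k) c)

  -- The product rule for formal power series. Through it the binomial theorem is obtained from a
  -- differential equation, in `convolution-expTerm`.
  leibniz : ∀ a b k → fromℕ (suc k) * convolution a b (suc k) ≈ convolution (derivative a) b k + convolution a
    (derivative b) k
  leibniz a b zero =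
      (solve 5 (λ z0 z1 z2 z3 z4 →
          z0 :* (z1 :* z2 :+ z3 :* z4) :=
          z0 :* z3 :* z4 :+ z1 :* (z0 :* z2)) refl
        (fromℕ 1) (a 0) (b 1) (a 1) (b 0))
  leibniz a b (suc k) = begin-equality
    (1# + K) * (a 0 * b₂ + c)
      ≈⟨
          (solve 4 (λ z0 K b₂ c →
              ((con (+ 1)) :+ K) :* (z0 :* b₂ :+ c) :=
              c :+ z0 :* (((con (+ 1)) :+ K) :* b₂) :+ K :* c) refl
            (a 0) K b₂ c) ⟩
    c + a 0 * ((1# + K) * b₂) + K * c
      ≈⟨ +-congˡ (leibniz a′ b k) ⟩
    c + a 0 * ((1# + K) * b₂) + (convolution (derivative a′) b k + convolution a′ (derivative b) k)
      ≈⟨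
          (solve 6 (λ z0 z1 z2 z3 z4 z5 →
              (z0 :* z1 :+ z2) :+ z3 :+ (z4 :+ z5) :=
              (((con (+ 1)) :+ (con (+ 0))) :* z0 :* z1 :+ (z2 :+ z4)) :+ (z3 :+ z5)) refl
            (a 1) (b (suc k)) (convolution (a′ ∘ suc) b k) (a 0 * ((1# + K) * b₂))
              (convolution (derivative a′) b k) (convolution a′ (derivative b) k)) ⟩
    (fromℕ 1 * a 1 * b (suc k) + (convolution (a′ ∘ suc) b k + convolution (derivative a′) b k)) +
      (a 0 * ((1# + K) * b₂) + convolution a′ (derivative b) k)
      -- The spare summand `c` adds `a (i + 2)` to the `(i + 1) a (i + 2)` from the derivative of
      -- the shifted sequence, which completes the derivative of `a` itself.
      ≈⟨ +-congʳ (+-congˡ (trans (sym (convolution-+ (a′ ∘ suc) (derivative a′) b k))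
           (convolution-cong (λ i →
               (solve 2 (λ z0 z1 →
                   z0 :+ z1 :* z0 :=
                   ((con (+ 1)) :+ z1) :* z0) refl
                 (a (suc (suc i))) (fromℕ (suc i)))) (λ _ → refl) k))) ⟩
    convolution (derivative a) b (suc k) + convolution a (derivative b) (suc k) ∎
    where
    a′ = a ∘ suc
    K = fromℕ (suc k)
    b₂ = b (suc (suc k))
    c = convolution a′ b (suc k)

  -- The exponential function

  expTerm : Carrier → ℕ → Carrier
  expTerm x k = x ^ k / fromℕ (k !)

  0<factorial : ∀ k → 0# < fromℕ (k !)
  0<factorial k = 0<fromℕ (k !) {{ℕ.>-nonZero (ℕ.1≤n! k)}}

  derivative-expTerm : ∀ x k → derivative (expTerm x) k ≈ x * expTerm x k
  derivative-expTerm x k = begin-equality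
    K * (x * X * fromℕ (suc k !) ⁻¹)     ≈⟨
        (solve 4 (λ z0 K x X →
            K :* (x :* X :* z0) :=
            x :* (X :* (K :* z0))) refl
          (fromℕ (suc k !) ⁻¹) K x X) ⟩
    x * (X * (K * fromℕ (suc k !) ⁻¹))   ≈⟨ *-congˡ (*-congˡ (⁻¹-unique (0<factorial k) reciprocal)) ⟩
    x * (X * fromℕ (k !) ⁻¹)             ∎
    where
    K = fromℕ (suc k)
    X = x ^ k
    reciprocal : K * fromℕ (suc k !) ⁻¹ * fromℕ (k !) ≈ 1#
    reciprocal = begin-equality
      K * fromℕ (suc k !) ⁻¹ * fromℕ (k !)     ≈⟨
          (solve 3 (λ z0 z1 K →
              K :* z0 :* z1 :=
              K :* z1 :* z0) refl
            (fromℕ (suc k !) ⁻¹) (fromℕ (k !)) K) ⟩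
      K * fromℕ (k !) * fromℕ (suc k !) ⁻¹     ≈⟨ *-congʳ (fromℕ-* (suc k) (k !)) ⟨
      fromℕ (suc k !) * fromℕ (suc k !) ⁻¹     ≈⟨ inverseʳ (0<factorial (suc k)) ⟩
      1#                                        ∎

  expTerm-0 : ∀ x → expTerm x 0 ≈ 1#
  expTerm-0 x = trans (*-identityˡ _) (sym (⁻¹-unique (0<fromℕ 1) (trans (*-identityˡ _) fromℕ-1)))

  -- Both sides start with 1 and have `x + y` times themselves as formal derivative; by induction
  -- they agree after multiplication by `k + 1`.
  convolution-expTerm : ∀ x y k → convolution (expTerm x) (expTerm y) k ≈ expTerm (x + y) k
  convolution-expTerm x y zero =
    trans (*-cong (expTerm-0 x) (expTerm-0 y)) (trans (*-identityˡ 1#) (sym (expTerm-0 (x + y))))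
  convolution-expTerm x y (suc k) = *-cancelʳ-≈ (fromℕ (suc k)) (0<fromℕ (suc k)) (begin-equality
    convolution (expTerm x) (expTerm y) (suc k) * fromℕ (suc k)   ≈⟨ *-comm _ _ ⟩
    fromℕ (suc k) * convolution (expTerm x) (expTerm y) (suc k)   ≈⟨ leibniz (expTerm x) (expTerm y) k ⟩
    convolution (derivative (expTerm x)) (expTerm y) k + convolution (expTerm x) (derivative (expTerm y)) k
      ≈⟨ +-cong (trans (convolution-cong (derivative-expTerm x) (λ _ → refl) k)
        (convolution-scaleˡ x (expTerm x) (expTerm y) k))
                (trans (convolution-cong (λ _ → refl) (derivative-expTerm y) k)
                  (convolution-scaleʳ y (expTerm x) (expTerm y) k)) ⟩
    x * convolution (expTerm x) (expTerm y) k + y * convolution (expTerm x) (expTerm y) k  ≈⟨ distribʳ _ x y ⟨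
    (x + y) * convolution (expTerm x) (expTerm y) k               ≈⟨ *-congˡ (convolution-expTerm x y k) ⟩
    (x + y) * expTerm (x + y) k                                   ≈⟨ derivative-expTerm (x + y) k ⟨
    fromℕ (suc k) * expTerm (x + y) (suc k)                       ≈⟨ *-comm _ _ ⟩
    expTerm (x + y) (suc k) * fromℕ (suc k)                       ∎)

  expSum : Carrier → ℕ → Carrier
  expSum x = partialSum (expTerm x)

  triangleSum-expTerm : ∀ x y n → triangleSum (expTerm x) (expTerm y) n ≈ expSum (x + y) n
  triangleSum-expTerm x y n =
    trans (triangleSum-convolution (expTerm x) (expTerm y) n) (partialSum-cong (convolution-expTerm x y) n)

  expTerm-cong : ∀ {x y} → x ≈ y → ∀ k → expTerm x k ≈ expTerm y k
  expTerm-cong x≈y k = *-congʳ (^-congˡ k x≈y)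

  expTerm-nonNeg : ∀ {x} → 0# ≤ x → ∀ k → 0# ≤ expTerm x k
  expTerm-nonNeg 0≤x k = *-nonNeg (^-nonNeg 0≤x k) (<⇒≤ (⁻¹-pos (0<factorial k)))

  expTerm-mono : ∀ {x y} → 0# ≤ x → x ≤ y → ∀ k → expTerm x k ≤ expTerm y k
  expTerm-mono 0≤x x≤y k = *-monoˡ-≤ _ (<⇒≤ (⁻¹-pos (0<factorial k))) (^-monoˡ-≤ 0≤x x≤y k)

  ∣^∣-≤ : ∀ x k → ∣ x ^ k ∣ ≤ ∣ x ∣ ^ k
  ∣^∣-≤ x zero    =
    ∣∣-≤ {1#} ≤-refl (≤-cancel (0≤1 ⊹ 0≤1)(solve 0 ((con (+ 1)) :+ ((con (+ 0)) :+ (con (+ 0))) := :-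
      (con (+ 1)) :+ ((con (+ 1)) :+ (con (+ 1)))) refl))
  ∣^∣-≤ x (suc k) = ≤-trans (∣∣-* x (x ^ k)) (*-monoʳ-≤ ∣ x ∣ (0≤∣x∣ x) (∣^∣-≤ x k))

  ∣expTerm∣-≤ : ∀ x k → ∣ expTerm x k ∣ ≤ expTerm ∣ x ∣ k
  ∣expTerm∣-≤ x k =
    ≤-trans (∣∣-* (x ^ k) i) (*-mono-≤ (0≤∣x∣ (x ^ k)) (∣^∣-≤ x k) (0≤∣x∣ i) (∣∣-≤ {i} ≤-refl (≤-cancel (0≤i ⊹ 0≤i)
      (solve 1 (λ i →
          i :+ ((con (+ 0)) :+ (con (+ 0))) :=
          :- i :+ (i :+ i)) refl
        i))))
    where
    i = fromℕ (k !) ⁻¹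
    0≤i = <⇒≤ (⁻¹-pos (0<factorial k))

  -- With each nonnegative sequence as its own majorant, the right side of `product-triangle-bound`
  -- bounds an absolute value and is therefore nonnegative.
  expSum-product-≥ : ∀ {x y} → 0# ≤ x → 0# ≤ y → ∀ n → expSum (x + y) n ≤ expSum x n * expSum y n
  expSum-product-≥ {x} {y} 0≤x 0≤y n = ≤-respˡ-≈ (triangleSum-expTerm x y n)
    (≤-cancel (≤-trans (0≤∣x∣ _) (product-triangle-bound {expTerm x} {expTerm x} {expTerm y} {expTerm y} (own 0≤x)
      (own 0≤y) {n} ℕ.≤-refl))

          (solve 3 (λ z0 z1 z2 →
              z0 :* z1 :+ (con (+ 0)) :=
              z2 :+ (z0 :* z1 :- z2)) refl
            (expSum x n) (expSum y n) (triangleSum (expTerm x) (expTerm y) n)))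
    where
    own : ∀ {x} → 0# ≤ x → ∀ k → ∣ expTerm x k ∣ ≤ expTerm x k
    own {x} 0≤x k = let e = expTerm x k ; 0≤e = expTerm-nonNeg 0≤x k in
      ∣∣-≤ {e} ≤-refl (≤-cancel (0≤e ⊹ 0≤e)
          (solve 1 (λ e →
              e :+ ((con (+ 0)) :+ (con (+ 0))) :=
              :- e :+ (e :+ e)) refl
            e))

  expSum-geometric : ∀ {h} → 0# ≤ h → h < 1# → ∀ n → expSum h n ≤ 1# / (1# - h)
  expSum-geometric {h} 0≤h h<1 n =
    ≤-trans (partialSum-mono term-≤ n) (≤-/ (difference-pos h<1) (≤-cancel (^-nonNeg 0≤h n) (geometric n)))
    where
    term-≤ : ∀ k → expTerm h k ≤ h ^ k
    term-≤ k = /-≤ (0<factorial k) (≤-respˡ-≈ (*-identityʳ _)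
      (*-monoʳ-≤ (h ^ k) (^-nonNeg 0≤h k) (≤-respˡ-≈ fromℕ-1 (fromℕ-mono-≤ (ℕ.1≤n! k)))))
    geometric : ∀ n → 1# + 0# ≈ partialSum (h ^_) n * (1# - h) + h ^ n
    geometric zero    =
        (solve 1 (λ h →
            (con (+ 1)) :+ (con (+ 0)) :=
            (con (+ 0)) :* ((con (+ 1)) :- h) :+ (con (+ 1))) refl
          h)
    geometric (suc n) = trans (geometric n) (trans
        (solve 3 (λ z0 z1 h →
            z0 :* ((con (+ 1)) :- h) :+ z1 :=
            (z0 :+ z1) :* ((con (+ 1)) :- h) :+ h :* z1) refl
          (partialSum (h ^_) n) (h ^ n) h)
      (+-congʳ (*-congʳ (sym (partialSum-last (h ^_) n)))))

  -- The geometric bound is available below 1 only, so `x` is dominated by a multiple of `½`, and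
  -- the bounds are multiplied along `expSum-product-≥`.
  expSum-bounded : ∀ {x} → 0# ≤ x → ∃[ B ] ∀ n → expSum x n ≤ B
  expSum-bounded {x} 0≤x =
    proj₁ (multiple M) , λ n → ≤-trans (partialSum-mono (expTerm-mono 0≤x x≤M½) n) (proj₂ (multiple M) n)
    where
    M = proj₁ (archimedean (x + x))
    x≤M½ : x ≤ fromℕ M * ½
    x≤M½ = ≤-respˡ-≈ (trans (distribʳ ½ x x) (half-sum x)) (*-monoˡ-≤ ½ (<⇒≤ 0<½) (<⇒≤ (proj₂ (archimedean (x + x)))))
    G = 1# / (1# - ½)
    0≤m½ : ∀ m → 0# ≤ fromℕ m * ½
    0≤m½ m = *-nonNeg (0≤fromℕ m) (<⇒≤ 0<½)
    multiple : ∀ m → ∃[ B ] ∀ n → expSum (fromℕ m * ½) n ≤ B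
    multiple zero    =
      G , λ n → ≤-trans (partialSum-mono (expTerm-mono (0≤m½ 0) (≤-respˡ-≈ (sym (zeroˡ ½)) (<⇒≤ 0<½))) n)
        (expSum-geometric (<⇒≤ 0<½) ½<1 n)
    multiple (suc m) = G * proj₁ (multiple m) , λ n → begin
      expSum (fromℕ (suc m) * ½) n                ≈⟨ partialSum-cong (expTerm-cong
          (solve 2 (λ z0 ½ →
              ((con (+ 1)) :+ z0) :* ½ :=
              ½ :+ z0 :* ½) refl
            (fromℕ m) ½)) n ⟩
      expSum (½ + fromℕ m * ½) n                  ≤⟨ expSum-product-≥ (<⇒≤ 0<½) (0≤m½ m) n ⟩
      expSum ½ n * expSum (fromℕ m * ½) n
        ≤⟨ *-mono-≤ (partialSum-nonNeg (expTerm-nonNeg (<⇒≤ 0<½)) n) (expSum-geometric (<⇒≤ 0<½) ½<1 n)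
                                                       (partialSum-nonNeg (expTerm-nonNeg (0≤m½ m)) n)
                                                         (proj₂ (multiple m) n) ⟩
      G * proj₁ (multiple m)                      ∎

  exp-converges : ∀ x → expSum x ConvergesTo exp x
  exp-converges x = choose-satisfies 0# (expSum x ConvergesTo_)
    (absolutely-convergent {expTerm x} (∣expTerm∣-≤ x) (proj₂ (expSum-bounded (0≤∣x∣ x))))

  exp-cong : ∀ {x y} → x ≈ y → exp x ≈ exp y
  exp-cong {x} {y} x≈y =
    lim-unique (lim-cong {expSum x} (partialSum-cong (expTerm-cong x≈y)) (exp-converges x)) (exp-converges y)

  lim-double : ∀ {f l} → f ConvergesTo l → (λ n → f (n ℕ.+ n)) ConvergesTo l
  lim-double f→l ε 0<ε = let (K , close) = f→l ε 0<ε in K , λ n K≤n → close (n ℕ.+ n) (ℕ.≤-trans K≤n (ℕ.m≤m+n n n))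

  -- The error of the product of two `n`-term sums is at most the corresponding error for `∣ x ∣`
  -- and `∣ y ∣`. There the square lies between the triangles of sizes `n` and `n + n`, whose sums
  -- have the same limit.
  exp-+ : ∀ x y → exp (x + y) ≈ exp x * exp y
  exp-+ x y = antisym
    (≤-cancel (lim-≤ 0 (λ n _ → ≤-trans (-x≤∣x∣ (error n)) (error-≤ n)) (lim-neg error-limit) gap-limit)
      (solve 3 (λ z0 z1 z2 → z0 :* z1 :+ :- (z0 :* z1 :- z2) := z2 :+ (con (+ 0))) refl (exp x) (exp y) (exp (x + y))))
    (≤-cancel (lim-≤ 0 (λ n _ → ≤-trans (x≤∣x∣ (error n)) (error-≤ n)) error-limit gap-limit)
      (solve 3 (λ z0 z1 z2 → z0 :+ (z1 :* z2 :- z0) := z1 :* z2 :+ (con (+ 0))) refl (exp (x + y)) (exp x) (exp y)))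
    where
    p = ∣ x ∣
    q = ∣ y ∣
    error gap : ℕ → Carrier
    error n = expSum x n * expSum y n - expSum (x + y) n
    gap n = expSum (p + q) (n ℕ.+ n) - expSum (p + q) n
    error-≤ : ∀ n → ∣ error n ∣ ≤ gap n
    error-≤ n = begin
      ∣ error n ∣
        ≈⟨ ∣∣-cong (+-congˡ (-‿cong (triangleSum-expTerm x y n))) ⟨
      ∣ expSum x n * expSum y n - triangleSum (expTerm x) (expTerm y) n ∣
        ≤⟨ product-triangle-bound {expTerm x} {expTerm p} {expTerm y} {expTerm q} (∣expTerm∣-≤ x)
          (∣expTerm∣-≤ y) {n} ℕ.≤-refl ⟩
      expSum p n * expSum q n - triangleSum (expTerm p) (expTerm q) n
        ≤⟨ +-monoˡ-≤ _ (product-≤-triangle (expTerm-nonNeg (0≤∣x∣ x)) (expTerm-nonNeg (0≤∣x∣ y)) n n) ⟩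
      triangleSum (expTerm p) (expTerm q) (n ℕ.+ n) - triangleSum (expTerm p) (expTerm q) n
        ≈⟨ +-cong (triangleSum-expTerm p q (n ℕ.+ n)) (-‿cong (triangleSum-expTerm p q n)) ⟩
      gap n ∎
    error-limit : error ConvergesTo (exp x * exp y - exp (x + y))
    error-limit = lim-+ (lim-* (exp-converges x) (exp-converges y)) (lim-neg (exp-converges (x + y)))
    gap-limit : gap ConvergesTo 0#
    gap-limit = lim-resp (-‿inverseʳ (exp (p + q)))
      (lim-+ (lim-double (exp-converges (p + q))) (lim-neg (exp-converges (p + q))))
      where
      lim-resp : ∀ {f a b} → a ≈ b → f ConvergesTo a → f ConvergesTo b
      lim-resp a≈b f→a ε 0<ε = let (K , close) = f→a ε 0<ε in K , λ n K≤n → <-respˡ (∣∣-cong (+-congˡ (-‿cong a≈b))) (close n K≤n)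

  1+x≤exp : ∀ {x} → 0# ≤ x → 1# + x ≤ exp x
  1+x≤exp {x} 0≤x =
    lim-≤ 2 (λ n 2≤n → ≤-trans (≤-reflexive (sym two-terms)) (partialSum-mono-index (expTerm-nonNeg 0≤x) 2≤n))
    (lim-const (1# + x)) (exp-converges x)
    where
    1⁻¹≈1 : fromℕ 1 ⁻¹ ≈ 1#
    1⁻¹≈1 = sym (⁻¹-unique (0<fromℕ 1) (trans (*-identityˡ _) fromℕ-1))
    two-terms : expSum x 2 ≈ 1# + x
    two-terms = trans (+-cong (*-congˡ 1⁻¹≈1) (+-congʳ (*-congˡ 1⁻¹≈1)))
        (solve 1 (λ x →
            (con (+ 1)) :* (con (+ 1)) :+ (x :* (con (+ 1)) :* (con (+ 1)) :+ (con (+ 0))) :=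
            (con (+ 1)) :+ x) refl
          x)

  -- An upper bound for `exp` near zero: it settles the value `exp 0#` and takes the place of
  -- continuity in `exp-surjective`.
  exp-geometric : ∀ {h} → 0# ≤ h → h < 1# → exp h * (1# - h) ≤ 1#
  exp-geometric {h} 0≤h h<1 = ≤-respʳ-≈ (/-*-cancel (difference-pos h<1)) (*-monoˡ-≤ (1# - h) (<⇒≤ (difference-pos h<1))
    (lim-≤ 0 (λ n _ → expSum-geometric 0≤h h<1 n) (exp-converges h) (lim-const (1# / (1# - h)))))

  exp-0 : exp 0# ≈ 1#
  exp-0 = antisym (≤-respˡ-≈
      (solve 1 (λ z0 →
          z0 :* ((con (+ 1)) :- (con (+ 0))) :=
          z0) refl
        (exp 0#)) (exp-geometric ≤-refl 0<1)) (≤-respˡ-≈ (+-identityʳ 1#) (1+x≤exp ≤-refl))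

  exp-neg : ∀ x → exp (- x) * exp x ≈ 1#
  exp-neg x = trans (sym (exp-+ (- x) x)) (trans (exp-cong (-‿inverseˡ x)) exp-0)

  exp-nonNeg : ∀ x → 0# ≤ exp x
  exp-nonNeg x = ≤-respʳ-≈ (trans (sym (exp-+ (x * ½) (x * ½))) (exp-cong (half-sum x))) (square-nonNeg (exp (x * ½)))

  exp-pos : ∀ x → 0# < exp x
  exp-pos x = exp-nonNeg x , λ 0≈e → 0≉1 (trans (sym (zeroʳ (exp (- x)))) (trans (*-congˡ 0≈e) (exp-neg x)))

  exp-mono-< : ∀ {x y} → x < y → exp x < exp y
  exp-mono-< {x} {y} x<y = begin-strict
    exp x                  <⟨ x<x+y (exp x) (*-pos (exp-pos x) 0<d) ⟩
    exp x + exp x * d      ≈⟨ (solve 2 (λ z0 d → z0 :+ z0 :* d := z0 :* ((con (+ 1)) :+ d)) refl (exp x) d) ⟩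
    exp x * (1# + d)       ≤⟨ *-monoʳ-≤ (exp x) (exp-nonNeg x) (1+x≤exp (<⇒≤ 0<d)) ⟩
    exp x * exp d          ≈⟨ exp-+ x d ⟨
    exp (x + (y - x))      ≈⟨ exp-cong (solve 2 (λ x y → x :+ (y :- x) := y) refl x y) ⟩
    exp y                  ∎
    where
    d = y - x
    0<d = difference-pos x<y

  exp-mono-≤ : ∀ {x y} → x ≤ y → exp x ≤ exp y
  exp-mono-≤ {x} {y} x≤y = ≮⇒≥ λ ey<ex → <-irrefl (<-respˡ (exp-cong (antisym (y≤x ey<ex) x≤y)) ey<ex)
    where
    y≤x : exp y < exp x → y ≤ x
    y≤x ey<ex = ≮⇒≥ λ x<y → <⇒≱ (exp-mono-< x<y) (<⇒≤ ey<ex)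

  exp-cancel-≤ : ∀ {x y} → exp x ≤ exp y → x ≤ y
  exp-cancel-≤ ex≤ey = ≮⇒≥ λ y<x → <⇒≱ (exp-mono-< y<x) ex≤ey

  exp-injective : ∀ {x y} → exp x ≈ exp y → x ≈ y
  exp-injective ex≈ey = antisym (exp-cancel-≤ (≤-reflexive ex≈ey)) (exp-cancel-≤ (≤-reflexive (sym ex≈ey)))

  exp-fromℕ : ∀ n x → exp (fromℕ n * x) ≈ exp x ^ n
  exp-fromℕ zero    x = trans (exp-cong (zeroˡ x)) exp-0
  exp-fromℕ (suc n) x = begin-equality
    exp ((1# + fromℕ n) * x)       ≈⟨ exp-cong
        (solve 2 (λ z0 x →
            ((con (+ 1)) :+ z0) :* x :=
            x :+ z0 :* x) refl
          (fromℕ n) x) ⟩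
    exp (x + fromℕ n * x)          ≈⟨ exp-+ x (fromℕ n * x) ⟩
    exp x * exp (fromℕ n * x)      ≈⟨ *-congˡ (exp-fromℕ n x) ⟩
    exp x * exp x ^ n              ∎

  exp-surjective : ∀ {y} → 0# < y → ∃[ x ] exp x ≈ y
  exp-surjective {y} 0<y = s , antisym (≮⇒≥ too-large) (≮⇒≥ too-small)
    where
    Below : Carrier → Set
    Below x = exp x ≤ y
    0<1/y : 0# < y ⁻¹
    0<1/y = ⁻¹-pos 0<y
    -- The witness and the upper bound of `Below` both come from `1 + x ≤ exp x`: `exp (y ⁻¹)`
    -- exceeds `y ⁻¹`, and `exp y` exceeds `y`.
    inhabited : Below (- (y ⁻¹))
    inhabited = *-cancelʳ-≤ (exp (y ⁻¹)) (exp-pos (y ⁻¹)) (begin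
      exp (- (y ⁻¹)) * exp (y ⁻¹)     ≈⟨ exp-neg (y ⁻¹) ⟩
      1#                              ≤⟨ x≤x+y 1# (<⇒≤ 0<y) ⟩
      1# + y                          ≈⟨ trans (+-comm 1# y) (+-congˡ (sym (inverseʳ 0<y))) ⟩
      y + y * y ⁻¹                    ≈⟨ (solve 2 (λ z0 y → y :+ y :* z0 := y :* ((con (+ 1)) :+ z0)) refl (y ⁻¹) y) ⟩
      y * (1# + y ⁻¹)                 ≤⟨ *-monoʳ-≤ y (<⇒≤ 0<y) (1+x≤exp (<⇒≤ 0<1/y)) ⟩
      y * exp (y ⁻¹)                  ∎)
    bounded : UpperBound Below y
    bounded {x} ex≤y = exp-cancel-≤ (≤-trans ex≤y (≤-trans (x≤x+y y 0≤1) (≤-respˡ-≈ (+-comm 1# y) (1+x≤exp (<⇒≤ 0<y)))))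
    supremum : ∃ (IsSupremum Below)
    supremum = complete Below (- (y ⁻¹) , inhabited) (y , bounded)
    s = proj₁ supremum
    -- exp moves by at most the factor 1 / (1 - h) over a step h, so a step with
    -- 1 - h the ratio of exp s and y does not leap over y.
    too-small : ¬ exp s < y
    too-small es<y = <⇒≱ (x<x+y s 0<h) (proj₁ (proj₂ supremum) below)
      where
      h = 1# - exp s / y
      0<h : 0# < h
      0<h =
        difference-pos (*-cancelʳ-< y (<⇒≤ 0<y) (<-respˡ (sym (/-*-cancel 0<y)) (<-respʳ (sym (*-identityˡ y)) es<y)))
      h<1 : h < 1#
      h<1 = <-cancel (/-pos (exp-pos s) 0<y)
          (solve 1 (λ z0 →
              (con (+ 1)) :+ (con (+ 0)) :=
              (con (+ 1)) :- z0 :+ z0) refl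
            (exp s / y))
      below : exp (s + h) ≤ y
      below = begin
        exp (s + h)                   ≈⟨ exp-+ s h ⟩
        exp s * exp h                 ≈⟨ *-congʳ (/-*-cancel 0<y) ⟨
        exp s / y * y * exp h         ≈⟨
            (solve 3 (λ z0 z1 y →
                z0 :* y :* z1 :=
                y :* (z1 :* ((con (+ 1)) :- ((con (+ 1)) :- z0)))) refl
              (exp s / y) (exp h) y) ⟩
        y * (exp h * (1# - h))        ≤⟨ *-monoʳ-≤ y (<⇒≤ 0<y) (exp-geometric (<⇒≤ 0<h) h<1) ⟩
        y * 1#                        ≈⟨ *-identityʳ y ⟩
        y                             ∎
    too-large : ¬ y < exp s
    too-large y<es =
      <⇒≱ (<-cancel 0<h(solve 2 (λ s h → s :+ (con (+ 0)) := s :- h :+ h) refl s h)) (proj₂ (proj₂ supremum) upper)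
      where
      h = 1# - y / exp s
      0<h : 0# < h
      0<h =
        difference-pos (*-cancelʳ-< (exp s) (exp-nonNeg s)
          (<-respˡ (sym (/-*-cancel (exp-pos s))) (<-respʳ (sym (*-identityˡ (exp s))) y<es)))
      h<1 : h < 1#
      h<1 = <-cancel (/-pos 0<y (exp-pos s))
          (solve 1 (λ z0 →
              (con (+ 1)) :+ (con (+ 0)) :=
              (con (+ 1)) :- z0 :+ z0) refl
            (y / exp s))
      y≤ : y ≤ exp (s - h)
      y≤ = *-cancelʳ-≤ (exp h) (exp-pos h) (begin
        y * exp h                         ≈⟨ *-congʳ (/-*-cancel (exp-pos s)) ⟨
        y / exp s * exp s * exp h         ≈⟨
            (solve 3 (λ z0 z1 z2 →
                z0 :* z1 :* z2 :=
                z1 :* (z2 :* ((con (+ 1)) :- ((con (+ 1)) :- z0)))) refl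
              (y / exp s) (exp s) (exp h)) ⟩
        exp s * (exp h * (1# - h))        ≤⟨ *-monoʳ-≤ (exp s) (exp-nonNeg s) (exp-geometric (<⇒≤ 0<h) h<1) ⟩
        exp s * 1#                        ≈⟨ *-identityʳ (exp s) ⟩
        exp s                             ≈⟨ exp-cong (solve 2 (λ s h → s :- h :+ h := s) refl s h) ⟨
        exp (s - h + h)                   ≈⟨ exp-+ (s - h) h ⟩
        exp (s - h) * exp h               ∎)
      upper : UpperBound Below (s - h)
      upper ex≤y = exp-cancel-≤ (≤-trans ex≤y y≤)

  -- Logarithm, real powers and floor

  exp-log : ∀ {y} → 0# < y → exp (log y) ≈ y
  exp-log {y} 0<y = choose-satisfies 0# (λ x → exp x ≈ y) (exp-surjective 0<y)

  log-exp : ∀ {x y} → exp x ≈ y → log y ≈ x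
  log-exp {x} ex≈y = exp-injective (trans (exp-log (<-respʳ ex≈y (exp-pos x))) (sym ex≈y))

  ^ʳ-pos : ∀ {x} s → 0# < x → x ^ʳ s ≈ exp (s * log x)
  ^ʳ-pos {x} s 0<x with lem {P = 0# < x}
  ... | yes _  = refl
  ... | no ¬0<x = ⊥-elim (¬0<x 0<x)

  ^ʳ-nonNeg : ∀ x s → 0# ≤ x ^ʳ s
  ^ʳ-nonNeg x s with lem {P = 0# < x}
  ... | yes _ = exp-nonNeg _
  ... | no _ with lem {P = s ≈ 0#}
  ...   | yes _ = 0≤1
  ...   | no _  = ≤-refl

  floor-satisfies : ∀ {x} → 0# ≤ x → fromℤ ⌊ x ⌋ ≤ x × x < fromℤ ⌊ x ⌋ + 1#
  floor-satisfies {x} 0≤x = choose-satisfies 0ℤ (λ n → fromℤ n ≤ x × x < fromℤ n + 1#)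
    (let (M , x<M) = archimedean x in search M x<M)
    where
    search : ∀ M → x < fromℕ M → ∃[ n ] fromℤ n ≤ x × x < fromℤ n + 1#
    search zero    x<0 = ⊥-elim (<⇒≱ x<0 0≤x)
    search (suc M) x<M = [ (λ M≤x → + M , M≤x , <-respʳ (+-comm 1# (fromℕ M)) x<M) , search M ]′ (≤∨> (fromℕ M) x)

  -- Lower bounds for Hausdorff measure and dimension

  choose-elim : ∀ {a p q} {A : Set a} (d : A) (P : A → Set p) (R : A → Set q) → R d → (∀ x → P x → R x) → R (choose d P)
  choose-elim d P R Rd PR with lem {P = ∃ P}
  ... | yes (x , Px) = PR x Px
  ... | no _         = Rd

  -- Here and in `⨆-≥` the default `⊤⁺` satisfies the inequality as well, so it holds whether or not
  -- an extremum was found.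
  ⨅-≥ : ∀ {a} {I : Set a} (f : I → ℝ∞) w → (∀ i → w ≤∞ f i) → w ≤∞ ⨅ f
  ⨅-≥ f w w≤f = choose-elim ⊤⁺ (IsGreatestLowerBound f) (w ≤∞_) (w ≤⊤⁺) (λ v glb → proj₂ glb w w≤f)

  ⨆-≥ : ∀ {a} {I : Set a} (f : I → ℝ∞) i → f i ≤∞ ⨆ f
  ⨆-≥ f i = choose-elim ⊤⁺ (IsLeastUpperBound f) (f i ≤∞_) (f i ≤⊤⁺) (λ v lub → proj₁ lub i)

  dimH-≥ : ∀ E s → (∀ t → 0# ≤ t → hausdorffMeasure t E ≈∞ [ 0# ] → s ≤ t) → [ s ] ≤∞ dimH E
  dimH-≥ E s s≤ = ⨅-≥ (λ (t : ∃[ t ] (0# ≤ t) × (hausdorffMeasure t E ≈∞ [ 0# ])) → [ proj₁ t ]) [ s ] λ { (t , 0≤t , null) → [ s≤ t 0≤t null ] }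

  -- One fineness suffices, because the measure is the supremum of the premeasures over all of them.
  measure-positive : ∀ {c η} t E → 0# < c → 0# < η →
    (∀ (C : Cover η E) → [ c ] ≤∞ Σ∞ (λ n → diamPower t (Cover.part C n))) → ¬ hausdorffMeasure t E ≈∞ [ 0# ]
  measure-positive {c} {η} t E 0<c 0<η bound null = not-null null
    (≤∞-trans (⨅-≥ (λ (C : Cover η E) → Σ∞ (λ n → diamPower t (Cover.part C n))) [ c ] bound)
      (⨆-≥ (λ (η : Σ Carrier (0# <_)) → hausdorffPreMeasure t (proj₁ η) E) (η , 0<η)))
    where
    ≤∞-trans : ∀ {u v w} → u ≤∞ v → v ≤∞ w → u ≤∞ w
    ≤∞-trans = ≤⁺-trans ≤-trans
    not-null : ∀ {h} → h ≈∞ [ 0# ] → [ c ] ≤∞ h → ⊥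
    not-null [ h≈0 ] [ c≤h ] = <⇒≱ 0<c (≤-respʳ-≈ h≈0 c≤h)

  Σ∞-< : ∀ {f c} → ¬ [ c ] ≤∞ Σ∞ f → ∀ n → partialSum f n < c
  Σ∞-< {f} {c} c≰ n = bounded (⨆-≥ (λ n → [ partialSum f n ]) n) c≰
    where
    bounded : ∀ {v s} → [ s ] ≤∞ v → ¬ [ c ] ≤∞ v → s < c
    bounded {v} (_ ≤⊤⁺) c≰v = ⊥-elim (c≰v (_ ≤⊤⁺))
    bounded [ s≤k ]     c≰k = ≤-<-trans s≤k (≰⇒> λ c≤k → c≰k [ c≤k ])

  diamPower-inhabited : ∀ {U} t → Satisfiable U → diamPower t U ≈ diam U ^ʳ t
  diamPower-inhabited {U} t inhabited with lem {P = Satisfiable U}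
  ... | yes _ = refl
  ... | no ¬inhabited = ⊥-elim (¬inhabited inhabited)

  diamPower-nonNeg : ∀ U t → 0# ≤ diamPower t U
  diamPower-nonNeg U t with lem {P = Satisfiable U}
  ... | yes _ = ^ʳ-nonNeg (diam U) t
  ... | no _  = ≤-refl

  Distance : Subset → Subset
  Distance U d = ∃[ x ] ∃[ y ] x ∈ U × y ∈ U × d ≈ ∣ x - y ∣

  diam-supremum : ∀ {U η} → Satisfiable U → DiamAtMost η U → IsSupremum (Distance U) (diam U)
  diam-supremum {U} {η} (x , x∈U) small = choose-satisfies 0# (IsSupremum (Distance U))
    (complete (Distance U) (∣ x - x ∣ , x , x , x∈U , x∈U , refl) (η , λ { (y , z , y∈U , z∈U , d≈) → ≤-respˡ-≈ (sym d≈) (small y∈U z∈U) }))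

  difference≤diam : ∀ {U η x y} → DiamAtMost η U → x ∈ U → y ∈ U → x - y ≤ diam U
  difference≤diam {U} {η} {x} {y} small x∈U y∈U = ≤-trans (x≤∣x∣ (x - y))
    (proj₁ (diam-supremum (x , x∈U) small) (x , y , x∈U , y∈U , refl))

  diam≤ : ∀ {U η} → Satisfiable U → DiamAtMost η U → diam U ≤ η
  diam≤ inhabited small = proj₂ (diam-supremum inhabited small) λ { (y , z , y∈U , z∈U , d≈) → ≤-respˡ-≈ (sym d≈) (small y∈U z∈U) }

  half-power : ∀ n → ½ ^ suc n + ½ ^ suc n ≈ ½ ^ n
  half-power n = trans (+-cong (*-comm _ _) (*-comm _ _)) (half-sum (½ ^ n))

  -- With γ = exp (- g) and t g ≤ log M, the set function diamᵗ dominates the mass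
  -- distribution that gives M ^ (- k) to an interval of length γ ^ k.
  power-≥ : ∀ {t g M} → 0# ≤ t → 0# < M → t * g ≤ log M → ∀ {d} k → exp (- g) ^ k ≤ d → (M ⁻¹) ^ k ≤ d ^ʳ t
  power-≥ {t} {g} {M} 0≤t 0<M tg≤logM {d} k γᵏ≤d = begin
    (M ⁻¹) ^ k                   ≈⟨ ^-congˡ k (⁻¹-unique 0<M (trans (*-congˡ (sym (exp-log 0<M))) (exp-neg (log M)))) ⟨
    exp (- log M) ^ k            ≈⟨ exp-fromℕ k (- log M) ⟨
    exp (K * - log M)            ≤⟨ exp-mono-≤ exponent-≤ ⟩
    exp (t * log d)              ≈⟨ ^ʳ-pos t 0<d ⟨
    d ^ʳ t                       ∎
    where
    K = fromℕ k
    0<d : 0# < d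
    0<d = <-≤-trans (^-pos (exp-pos (- g)) k) γᵏ≤d
    log-≥ : K * - g ≤ log d
    log-≥ = exp-cancel-≤ (≤-respˡ-≈ (sym (exp-fromℕ k (- g))) (≤-respʳ-≈ (sym (exp-log 0<d)) γᵏ≤d))
    exponent-≤ : K * - log M ≤ t * log d
    exponent-≤ = ≤-trans (≤-cancel (*-monoʳ-≤ K (0≤fromℕ k) tg≤logM)

          (solve 4 (λ z0 t K g →
              t :* (K :* :- g) :+ K :* (t :* g) :=
              K :* :- z0 :+ K :* z0) refl
            (log M) t K g)) (*-monoʳ-≤ t 0≤t log-≥)

  -- Indicators and finite sums

  indicator : Set → Carrier
  indicator P = if does (lem {P = P}) then 1# else 0#

  indicator-yes : ∀ {P} → P → indicator P ≈ 1#
  indicator-yes {P} p with lem {P = P}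
  ... | yes _ = refl
  ... | no ¬p = ⊥-elim (¬p p)

  indicator-no : ∀ {P} → ¬ P → indicator P ≈ 0#
  indicator-no {P} ¬p with lem {P = P}
  ... | yes p = ⊥-elim (¬p p)
  ... | no _  = refl

  indicator-nonNeg : ∀ P → 0# ≤ indicator P
  indicator-nonNeg P with lem {P = P}
  ... | yes _ = 0≤1
  ... | no _  = ≤-refl

  partialSum-swap : ∀ (f : ℕ → ℕ → Carrier) m n →
    partialSum (λ i → partialSum (f i) n) m ≈ partialSum (λ j → partialSum (λ i → f i j) m) n
  partialSum-swap f zero n =
    sym (trans (partialSum-cong (λ _ → sym (zeroˡ 0#)) n) (trans (partialSum-* 0# (λ _ → 0#) n) (zeroˡ _)))
  partialSum-swap f (suc m) n =
    trans (+-congˡ (partialSum-swap (f ∘ suc) m n))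
      (sym (partialSum-+ (f 0) (λ j → partialSum (λ i → f (suc i) j) m) n))

  count≤partialSum : ∀ {f} n → (∀ j → j ℕ.< n → 1# ≤ f j) → fromℕ n ≤ partialSum f n
  count≤partialSum zero    1≤f = ≤-refl
  count≤partialSum (suc n) 1≤f = 1≤f 0 ℕ.z<s ⊹ count≤partialSum n (λ j j<n → 1≤f (suc j) (ℕ.s<s j<n))

  term≤partialSum : ∀ {f} → (∀ k → 0# ≤ f k) → ∀ n → f n ≤ partialSum f (suc n)
  term≤partialSum {f} 0≤f n =
    ≤-respʳ-≈ (trans (+-comm _ _) (sym (partialSum-last f n))) (x≤x+y (f n) (partialSum-nonNeg 0≤f n))

  -- Serves to give the finitely many children of a node one common number of cover sets, in
  -- `good-child`.
  common-bound : ∀ {P : ℕ → ℕ → Set} → (∀ {j J J′} → J ℕ.≤ J′ → P j J → P j J′) → ∀ n → (∀ j → j ℕ.< n → ∃ (P j)) →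
    ∃[ J ] (∀ j → j ℕ.< n → P j J)
  common-bound mono zero    each = 0 , λ _ ()
  common-bound mono (suc n) each =
    let (J₁ , all₁) = common-bound mono n (λ j j<n → each j (ℕ.m<n⇒m<1+n j<n))
        (J₂ , last) = each n ℕ.≤-refl
    in J₁ ℕ.⊔ J₂ , λ j j<1+n → [ (λ j<n → mono (ℕ.m≤m⊔n J₁ J₂) (all₁ j j<n)) , (λ { ≡.refl → mono (ℕ.m≤n⊔m J₁ J₂) last }) ]′ (ℕ.m≤n⇒m<n∨m≡n (ℕ.≤-pred j<1+n))

  -- One move of the game

  six : Carrier → Carrier
  six u = (u + u) + (u + u) + (u + u)

  -- If neighbourhoods come near both outer thirds, their centres satisfy
  -- `a - u < c₁ < a + 3u < c₃ < a + 7u`, and the spacing gives `c₁ + 6u < c₃`. A centre `c` near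
  -- the middle third has `a + u < c < a + 5u`. Hence `c < c₁ + 6u < c₃`, and by the spacing
  -- `c + 6u < c₃ < a + 7u`, which contradicts `a + u < c`.
  free-third : (C : Carrier → Set) (a u : Carrier) → 0# < u →
    (∀ {c d} → C c → C d → c < d → c + six u < d) →
    ∃[ b ] a ≤ b × b + (u + u) ≤ a + six u ×
      (∀ {x c} → b ≤ x → x ≤ b + (u + u) → C c → c + u ≤ x ⊎ x + u ≤ c)
  free-third C a u 0<u spaced = choice (lem {P = ∃[ c ] Near a c}) (lem {P = ∃[ c ] Near (a + w + w) c})
    where
    w = u + u
    0≤w = +-nonNeg (<⇒≤ 0<u) (<⇒≤ 0<u)
    Near : Carrier → Carrier → Set
    Near b c = C c × b < c + u × c < b + w + u
    Free : Carrier → Set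
    Free b = a ≤ b × b + w ≤ a + six u × (∀ {x c} → b ≤ x → x ≤ b + w → C c → c + u ≤ x ⊎ x + u ≤ c)
    clear : ∀ {b} → ¬ (∃[ c ] Near b c) → ∀ {x c} → b ≤ x → x ≤ b + w → C c → c + u ≤ x ⊎ x + u ≤ c
    clear {b} none {x} {c} b≤x x≤b+w Cc with ≤∨> (c + u) b
    ... | inj₁ c+u≤b = inj₁ (≤-trans c+u≤b b≤x)
    ... | inj₂ b<c+u = inj₂ (≤-trans (+-monoˡ-≤ u x≤b+w) (≮⇒≥ λ c<b+w+u → none (c , Cc , b<c+u , c<b+w+u)))
    choice : Dec (∃[ c ] Near a c) → Dec (∃[ c ] Near (a + w + w) c) → ∃[ b ] Free b
    choice (no none) _ = a , ≤-refl ,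
      ≤-cancel (0≤w ⊹ 0≤w)
          (solve 2 (λ a w →
              a :+ (w :+ w :+ w) :+ ((con (+ 0)) :+ (con (+ 0))) :=
              a :+ w :+ (w :+ w)) refl
            a w) , clear none
    choice (yes _) (no none) = a + w + w ,
      ≤-cancel (0≤w ⊹ 0≤w) (solve 2 (λ a w → a :+ w :+ w :+ ((con (+ 0)) :+ (con (+ 0))) := a :+ (w :+ w)) refl a w) ,
      ≤-reflexive (solve 2 (λ a w → a :+ w :+ w :+ w := a :+ (w :+ w :+ w)) refl a w) , clear none
    choice (yes (c₁ , C₁ , low₁ , high₁)) (yes (c₃ , C₃ , low₃ , high₃)) = a + w ,
      ≤-cancel 0≤w (solve 2 (λ a w → a :+ w :+ (con (+ 0)) := a :+ w) refl a w) ,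
      ≤-cancel 0≤w (solve 2 (λ a w → a :+ (w :+ w :+ w) :+ (con (+ 0)) := a :+ w :+ w :+ w) refl a w) ,
      clear λ { (c , Cc , low , high) → middle Cc low high }
      where
      c₁<c₃ : c₁ < c₃
      c₁<c₃ = <-cancel (<⇒≤ high₁ ⊹< low₃)
          (solve 4 (λ c₃ c₁ a u →
              c₃ :+ (c₁ :+ (a :+ (u :+ u) :+ (u :+ u))) :=
              c₁ :+ (a :+ (u :+ u) :+ u :+ (c₃ :+ u))) refl
            c₃ c₁ a u)
      middle : ∀ {c} → C c → a + w < c + u → c < a + w + w + u → ⊥
      middle {c} Cc low high = <-irrefl {0#} (<-cancel (<⇒≤ low ⊹ <⇒≤ (spaced Cc C₃ c<c₃) ⊹< high₃)

            (solve 4 (λ a u c c₃ →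
                (con (+ 0)) :+ (a :+ (u :+ u) :+ (c :+ ((u :+ u) :+ (u :+ u) :+ (u :+ u))) :+ c₃) :=
                (con (+ 0)) :+ (c :+ u :+ c₃ :+ (a :+ (u :+ u) :+ (u :+ u) :+ (u :+ u) :+ u))) refl
              a u c c₃))
        where
        c<c₃ : c < c₃
        c<c₃ = <-cancel (<⇒≤ low₁ ⊹ <⇒≤ high ⊹< spaced C₁ C₃ c₁<c₃)

              (solve 5 (λ c₃ a c c₁ u →
                  c₃ :+ (a :+ c :+ (c₁ :+ ((u :+ u) :+ (u :+ u) :+ (u :+ u)))) :=
                  c :+ (c₁ :+ u :+ (a :+ (u :+ u) :+ (u :+ u) :+ u) :+ c₃)) refl
                c₃ a c c₁ u)

  -- Decay of powers

  -- For a ratio of at most one half, `(k + 1) γ^k ≤ 1` holds by induction, and the archimedean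
  -- property gives a `K` above `X`.
  power-vanishes : ∀ {γ} → 0# < γ → γ + γ ≤ 1# → ∀ X → ∃[ K ] ∀ k → K ℕ.≤ k → X * γ ^ k < 1#
  power-vanishes {γ} 0<γ 2γ≤1 X = K , λ k K≤k → begin-strict
    X * γ ^ k                <⟨ *-monoˡ-< (γ ^ k) (^-pos 0<γ k) (proj₂ (archimedean X)) ⟩
    fromℕ K * γ ^ k          ≤⟨ *-monoˡ-≤ (γ ^ k) (<⇒≤ (^-pos 0<γ k)) (fromℕ-mono-≤ (ℕ.≤-trans K≤k (ℕ.n≤1+n k))) ⟩
    fromℕ (suc k) * γ ^ k    ≤⟨ bernoulli k ⟩
    1#                       ∎
    where
    K = proj₁ (archimedean X)
    0≤γ = <⇒≤ 0<γ
    γ≤1 : γ ≤ 1#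
    γ≤1 = ≤-trans (x≤x+y γ 0≤γ) 2γ≤1
    bernoulli : ∀ k → fromℕ (suc k) * γ ^ k ≤ 1#
    bernoulli zero    = ≤-reflexive (trans (*-identityʳ _) fromℕ-1)
    bernoulli (suc k) = begin
      (1# + K′) * (γ * γ ^ k)             ≈⟨
          (solve 3 (λ z0 K′ γ →
              ((con (+ 1)) :+ K′) :* (γ :* z0) :=
              γ :* z0 :+ γ :* (K′ :* z0)) refl
            (γ ^ k) K′ γ) ⟩
      γ * γ ^ k + γ * (K′ * γ ^ k)        ≤⟨ *-monoʳ-≤ γ 0≤γ (^-≤1 0≤γ γ≤1 k) ⊹ *-monoʳ-≤ γ 0≤γ (bernoulli k) ⟩
      γ * 1# + γ * 1#                     ≈⟨ +-cong (*-identityʳ γ) (*-identityʳ γ) ⟩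
      γ + γ                               ≤⟨ 2γ≤1 ⟩
      1#                                  ∎
      where
      K′ = fromℕ (suc k)

  first-crossing : (P : ℕ → Set) → ¬ P 0 → ∀ {n} → P n → ∃[ k ] ¬ P k × P (suc k)
  first-crossing P ¬P0 {zero}  P0 = ⊥-elim (¬P0 P0)
  first-crossing P ¬P0 {suc n} Pn with lem {P = P n}
  ... | yes Pn′ = first-crossing P ¬P0 Pn′
  ... | no ¬Pn  = n , ¬Pn , Pn

  -- The tree of intervals

  module Construction {N′ : ℕ} (r : Fin (suc N′) → Carrier) (δ γ u₀ : Carrier) (m : ℕ)
    (0<δ : 0# < δ) (0<γ : 0# < γ) (0<u₀ : 0# < u₀) (1≤m : 1 ℕ.≤ m)
    (γ^N≈6δ : γ ^ suc N′ ≈ six δ) (3mγ≤1 : (1# + 1# + 1#) * (fromℕ m * γ) ≤ 1#) where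

    private
      N = suc N′

    -- The radius to be avoided at depth `k`, and at the same time one sixth of the length there.
    -- The scale `u₀` stays open: density asks for a short root, the dimension estimate for one of
    -- length 1.
    u : ℕ → Carrier
    u k = u₀ * γ ^ k

    len : ℕ → Carrier
    len k = six (u k)

    0<u : ∀ k → 0# < u k
    0<u k = *-pos 0<u₀ (^-pos 0<γ k)

    0<six : ∀ {v} → 0# < v → 0# < six v
    0<six 0<v = let 0≤2v = +-nonNeg (<⇒≤ 0<v) (<⇒≤ 0<v) in +-pos (+-nonNeg 0≤2v 0≤2v) (+-pos (<⇒≤ 0<v) 0<v)

    0<len : ∀ k → 0# < len k
    0<len k = 0<six (0<u k)

    3γ≤1 : (1# + 1# + 1#) * γ ≤ 1#
    3γ≤1 =
      ≤-trans (*-monoʳ-≤ _ (+-nonNeg (<⇒≤ 0<2) 0≤1)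
        (≤-respˡ-≈ (trans (*-congʳ fromℕ-1) (*-identityˡ γ)) (*-monoˡ-≤ γ (<⇒≤ 0<γ) (fromℕ-mono-≤ 1≤m)))) 3mγ≤1

    2γ≤1 : γ + γ ≤ 1#
    2γ≤1 = ≤-trans (≤-cancel (<⇒≤ 0<γ)
        (solve 1 (λ γ →
            ((con (+ 1)) :+ (con (+ 1)) :+ (con (+ 1))) :* γ :+ (con (+ 0)) :=
            γ :+ γ :+ γ) refl
          γ)) 3γ≤1

    -- The total length of the children is `3 m γ` times the third `u k + u k`.
    children-fit : ∀ k → fromℕ m * len (suc k) ≤ u k + u k
    children-fit k = ≤-respˡ-≈
        (solve 4 (λ u₀ g M γ →
            (u₀ :* g :+ u₀ :* g) :* (((con (+ 1)) :+ (con (+ 1)) :+ (con (+ 1))) :* (M :* γ)) :=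
            M :* ((u₀ :* (γ :* g) :+ u₀ :* (γ :* g)) :+ (u₀ :* (γ :* g) :+ u₀ :* (γ :* g)) :+
              (u₀ :* (γ :* g) :+ u₀ :* (γ :* g)))) refl
          u₀ g M γ)
      (≤-respʳ-≈ (*-identityʳ _) (*-monoʳ-≤ (u k + u k) (+-nonNeg (<⇒≤ (0<u k)) (<⇒≤ (0<u k))) 3mγ≤1))
      where
      g = γ ^ k
      M = fromℕ m

    turn : ℕ → Fin N
    turn k = k mod N

    time : Fin N → ℕ → ℕ
    time i n = toℕ i ℕ.+ n ℕ.* N

    turn-time : ∀ i n → turn (time i n) ≡ i
    turn-time i n = toℕ-injective (≡.trans (toℕ-fromℕ< _) (≡.trans ([m+kn]%n≡m%n (toℕ i) n N) (m<n⇒m%n≡m (toℕ<n i))))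

    -- The rationals p / q to be avoided at depth k, moved by the translation whose turn it is.
    Centre : ℕ → Carrier → Set
    Centre k c = ∃[ p ] ∃[ q ] 0# < fromℤ q × fromℤ q * fromℤ q * len k < 1# × (c - r (turn k)) * fromℤ q ≈ fromℤ p

    -- Two rationals p / q and p′ / q′ are at least 1 / (q q′) apart.
    centres-spaced : ∀ k {c d} → Centre k c → Centre k d → c < d → c + len k < d
    centres-spaced k {c} {d} (p , q , 0<q , q²ℓ<1 , c≈p/q) (p′ , q′ , 0<q′ , q′²ℓ<1 , d≈p′/q′) c<d =
      ≰⇒> λ d≤c+ℓ → <-irrefl (≤-<-trans (1≤square (≤-trans 1≤D (D≤ d≤c+ℓ))) square<1)
      where
      Q = fromℤ q
      Q′ = fromℤ q′
      ℓ = len k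
      s = r (turn k)
      t = Q * Q′ * ℓ
      D = (d - c) * (Q * Q′)
      numerator : fromℤ (p′ ℤ.* q ℤ.+ ℤ.- (p ℤ.* q′)) ≈ D
      numerator = begin-equality
        fromℤ (p′ ℤ.* q ℤ.+ ℤ.- (p ℤ.* q′))                   ≈⟨ fromℤ-+ (p′ ℤ.* q) (ℤ.- (p ℤ.* q′)) ⟩
        fromℤ (p′ ℤ.* q) + fromℤ (ℤ.- (p ℤ.* q′))
          ≈⟨ +-cong (fromℤ-* p′ q) (trans (fromℤ-neg (p ℤ.* q′)) (-‿cong (fromℤ-* p q′))) ⟩
        fromℤ p′ * Q - fromℤ p * Q′                           ≈⟨ +-cong (*-congʳ d≈p′/q′) (-‿cong (*-congʳ c≈p/q)) ⟨
        (d - s) * Q′ * Q - (c - s) * Q * Q′                   ≈⟨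
            (solve 5 (λ d s Q′ Q c →
                (d :- s) :* Q′ :* Q :- (c :- s) :* Q :* Q′ :=
                (d :- c) :* (Q :* Q′)) refl
              d s Q′ Q c) ⟩
        D                                                     ∎
      1≤D : 1# ≤ D
      1≤D =
        ≤-respʳ-≈ numerator (fromℤ-pos (p′ ℤ.* q ℤ.+ ℤ.- (p ℤ.* q′))
          (<-respʳ (sym numerator) (*-pos (difference-pos c<d) (*-pos 0<q 0<q′))))
      D≤ : d ≤ c + ℓ → D ≤ t
      D≤ d≤c+ℓ = ≤-respʳ-≈ (*-comm ℓ (Q * Q′)) (*-monoˡ-≤ (Q * Q′) (<⇒≤ (*-pos 0<q 0<q′)) (≤-cancel d≤c+ℓ
          (solve 3 (λ ℓ d c →
              ℓ :+ d :=
              d :- c :+ (c :+ ℓ)) refl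
            ℓ d c)))
      -- The bound on `D` mixes the two denominators; its square is the product of the separate
      -- conditions on `q` and `q′`.
      1≤square : 1# ≤ t → 1# ≤ t * t
      1≤square 1≤t = ≤-respˡ-≈ (*-identityˡ 1#) (*-mono-≤ 0≤1 1≤t 0≤1 1≤t)
      square<1 : t * t < 1#
      square<1 = begin-strict
        t * t                         ≈⟨
            (solve 3 (λ Q Q′ ℓ →
                Q :* Q′ :* ℓ :* (Q :* Q′ :* ℓ) :=
                Q :* Q :* ℓ :* (Q′ :* Q′ :* ℓ)) refl
              Q Q′ ℓ) ⟩
        Q * Q * ℓ * (Q′ * Q′ * ℓ)     <⟨ *-monoʳ-< _ (*-pos (*-pos 0<q 0<q) (0<len k)) q′²ℓ<1 ⟩
        Q * Q * ℓ * 1#                ≈⟨ *-identityʳ _ ⟩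
        Q * Q * ℓ                     <⟨ q²ℓ<1 ⟩
        1#                            ∎

    third : ∀ k a → ∃[ b ] a ≤ b × b + (u k + u k) ≤ a + len k ×
      (∀ {x c} → b ≤ x → x ≤ b + (u k + u k) → Centre k c → c + u k ≤ x ⊎ x + u k ≤ c)
    third k a = free-third (Centre k) a (u k) (0<u k) (centres-spaced k)

    free : ℕ → Carrier → Carrier
    free k a = proj₁ (third k a)

    child : ℕ → Carrier → ℕ → Carrier
    child k a j = free k a + fromℕ j * len (suc k)

    free≤child : ∀ k a j → free k a ≤ child k a j
    free≤child k a j = x≤x+y _ (*-nonNeg (0≤fromℕ j) (<⇒≤ (0<len (suc k))))

    child-spaced : ∀ k a {i j} → i ℕ.< j → child k a i + len (suc k) ≤ child k a j
    child-spaced k a {i} {j} i<j = ≤-trans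
      (≤-reflexive
          (solve 3 (λ z0 z1 z2 →
              z0 :+ z1 :* z2 :+ z2 :=
              z0 :+ ((con (+ 1)) :+ z1) :* z2) refl
            (free k a) (fromℕ i) (len (suc k))))
      (+-monoʳ-≤ (free k a) (*-monoˡ-≤ _ (<⇒≤ (0<len (suc k))) (fromℕ-mono-≤ i<j)))

    child-inside : ∀ k a {j} → j ℕ.< m → child k a j + len (suc k) ≤ free k a + (u k + u k)
    child-inside k a j<m = ≤-trans (child-spaced k a j<m) (+-monoʳ-≤ (free k a) (children-fit k))

    child-lower : ∀ k a j → a ≤ child k a j
    child-lower k a j = ≤-trans (proj₁ (proj₂ (third k a))) (free≤child k a j)

    child-upper : ∀ k a {j} → j ℕ.< m → child k a j + len (suc k) ≤ a + len k
    child-upper k a j<m = ≤-trans (child-inside k a j<m) (proj₁ (proj₂ (proj₂ (third k a))))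

    Path : (ℕ → Carrier) → Set
    Path a = ∀ k → ∃[ j ] j ℕ.< m × a (suc k) ≡ child k (a k) j

    InAll : (ℕ → Carrier) → Carrier → Set
    InAll a x = ∀ k → a k ≤ x × x ≤ a k + len k

    path-limit : ∀ {a} → Path a → ∃[ x ] InAll a x
    path-limit {a} path = s , λ k → proj₁ (proj₂ supremum) (k , refl) , proj₂ (proj₂ supremum) (λ { (j , y≈aj) → ≤-respˡ-≈ (sym y≈aj) (below j k) })
      where
      lower : ∀ k → a k ≤ a (suc k)
      lower k = let (j , j<m , eq) = path k in ≡.subst (a k ≤_) (≡.sym eq) (child-lower k (a k) j)
      upper : ∀ k → - (a k + len k) ≤ - (a (suc k) + len (suc k))
      upper k = let (j , j<m , eq) = path k in
        ≤-cancel (≡.subst (λ b → b + len (suc k) ≤ a k + len k) (≡.sym eq) (child-upper k (a k) j<m))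
          (solve 2 (λ z0 z1 → :- z0 :+ z0 := :- z1 :+ z1) refl (a (suc k) + len (suc k)) (a k + len k))
      below : ∀ j k → a j ≤ a k + len k
      below j k = ≤-trans (monotone-≤ lower (ℕ.m≤m⊔n j k)) (≤-trans (x≤x+y (a n) (<⇒≤ (0<len n)))
        (≤-cancel (monotone-≤ upper (ℕ.m≤n⊔m j k))
            (solve 2 (λ z0 z1 →
                z0 :+ :- z0 :=
                z1 :+ :- z1) refl
              (a k + len k) (a n + len n))))
        where
        n = j ℕ.⊔ k
      Values : Carrier → Set
      Values y = ∃[ n ] y ≈ a n
      supremum : ∃ (IsSupremum Values)
      supremum = complete Values (a 0 , 0 , refl) (a 0 + len 0 , λ { (j , y≈aj) → ≤-respˡ-≈ (sym y≈aj) (below j 0) })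
      s = proj₁ supremum

    -- Limit points are badly approximable

    module _ {a : ℕ → Carrier} {x : Carrier} (path : Path a) (inAll : InAll a x) where

      -- The point lies in a child of its node at depth `k`, hence in the third that was chosen
      -- clear of the centres.
      separated : ∀ k {c} → Centre k c → c + u k ≤ x ⊎ x + u k ≤ c
      separated k =
        proj₂ (proj₂ (proj₂ (third k (a k)))) (≤-trans (free≤child k (a k) (proj₁ (path k))) (proj₁ next))
          (≤-trans (proj₂ next) (child-inside k (a k) (proj₁ (proj₂ (path k)))))
        where
        next : child k (a k) (proj₁ (path k)) ≤ x × x ≤ child k (a k) (proj₁ (path k)) + len (suc k)
        next = ≡.subst (λ b → b ≤ x × x ≤ b + len (suc k)) (proj₂ (proj₂ (path k))) (inAll (suc k))

      distance : ∀ i n p q → 0# < fromℤ q → fromℤ q * fromℤ q * len (time i n) < 1# →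
        u (time i n) ≤ ∣ (x - r i) - fromℤ p / fromℤ q ∣
      distance i n p q 0<q q²ℓ<1 = [ above , below ]′ (separated k centre)
        where
        k = time i n
        f = fromℤ p / fromℤ q
        y = x - r i
        centre : Centre k (r i + f)
        centre =
          p , q , 0<q , q²ℓ<1 , trans (*-congʳ (trans
            (+-congˡ (-‿cong (reflexive (≡.cong r (turn-time i n)))))(solve 2 (λ z0 f → z0 :+ f :- z0 := f) refl
              (r i) f))) (/-*-cancel 0<q)
        above : r i + f + u k ≤ x → u k ≤ ∣ y - f ∣
        above c+u≤x = ≤-trans (≤-cancel c+u≤x
            (solve 4 (λ z0 z1 x f →
                x :- z0 :- f :+ (z0 :+ f :+ z1) :=
                z1 :+ x) refl
              (r i) (u k) x f)) (x≤∣x∣ (y - f))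
        below : x + u k ≤ r i + f → u k ≤ ∣ y - f ∣
        below x+u≤c = ≤-trans (≤-cancel x+u≤c
            (solve 4 (λ z0 z1 x f →
                :- (x :- z0 :- f) :+ (x :+ z1) :=
                z1 :+ (z0 :+ f)) refl
              (r i) (u k) x f)) (-x≤∣x∣ (y - f))

      eventually-treated : ∀ i q → ∃[ n ] fromℤ q * fromℤ q * len (time i n) < 1#
      eventually-treated i q = K , <-respˡ
          (solve 3 (λ Q u₀ g →
              Q :* Q :* ((u₀ :+ u₀) :+ (u₀ :+ u₀) :+ (u₀ :+ u₀)) :* g :=
              Q :* Q :* ((u₀ :* g :+ u₀ :* g) :+ (u₀ :* g :+ u₀ :* g) :+ (u₀ :* g :+ u₀ :* g))) refl
            Q u₀ g) (vanishing (time i K) K≤time)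
        where
        Q = fromℤ q
        small = power-vanishes 0<γ 2γ≤1 (Q * Q * six u₀)
        K = proj₁ small
        vanishing = proj₂ small
        g = γ ^ time i K
        K≤time : K ℕ.≤ time i K
        K≤time = ℕ.≤-trans (ℕ.m≤m*n K N) (ℕ.m≤n+m (K ℕ.* N) (toℕ i))

      -- A rational value of `x - r i` would give a centre at some turn of `i`, and `x` would be at
      -- positive distance from itself.
      limit-irrational : ∀ i → Irrational (x - r i)
      limit-irrational i ρ y≈ρ =
        <⇒≱ (0<u (time i n)) (≤-trans (distance i n (↥ ρ) (↧ ρ) 0<q (proj₂ (eventually-treated i (↧ ρ))))
        (≤-trans (≤-reflexive (∣∣-cong (trans (+-congʳ y≈ρ) (-‿inverseʳ (fromℚ ρ)))))
          (∣∣-≤ {0#} ≤-refl (≤-reflexive -0#≈0#))))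
        where
        n = proj₁ (eventually-treated i (↧ ρ))
        0<q : 0# < fromℤ (↧ ρ)
        0<q = 0<fromℕ (suc (ℚ.ℚ.denominator-1 ρ))

      -- The `N` levels between two turns multiply the radius by `γ^N = 6δ`, and the six turns the
      -- radius into a length.
      next-radius : ∀ i n → u (time i (suc n)) ≈ δ * len (time i n)
      next-radius i n = begin-equality
        u₀ * γ ^ time i (suc n)       ≈⟨ *-congˡ (reflexive (≡.cong (γ ^_) shift)) ⟩
        u₀ * γ ^ (N ℕ.+ time i n)     ≈⟨ *-congˡ (trans (^-homo-* γ N (time i n)) (*-congʳ γ^N≈6δ)) ⟩
        u₀ * (six δ * g)              ≈⟨
            (solve 3 (λ u₀ δ g →
                u₀ :* (((δ :+ δ) :+ (δ :+ δ) :+ (δ :+ δ)) :* g) :=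
                δ :* ((u₀ :* g :+ u₀ :* g) :+ (u₀ :* g :+ u₀ :* g) :+ (u₀ :* g :+ u₀ :* g))) refl
              u₀ δ g) ⟩
        δ * len (time i n)            ∎
        where
        g = γ ^ time i n
        shift : time i (suc n) ≡ N ℕ.+ time i n
        shift =
          ≡.trans (≡.sym (ℕ.+-assoc (toℕ i) N _)) (≡.trans (≡.cong (ℕ._+ n ℕ.* N) (ℕ.+-comm (toℕ i) N))
            (ℕ.+-assoc N (toℕ i) _))

      -- For given `q` there are consecutive turns of `i` such that at the former, with length `ℓ`,
      -- still `q² ℓ ≥ 1`, while at the latter p/q is avoided. The radius there is `δ ℓ ≥ δ / q²`.
      limit-bad : ∀ i → Bad δ (x - r i)
      limit-bad i = limit-irrational i , + suc M , ℤ.+<+ (ℕ.s≤s ℕ.z≤n) , bound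
        where
        ℓ = len (toℕ i)
        -- For `q > M` already `q² ℓ ≥ q ℓ ≥ 1` at the first turn of `i`, so a turn at which `q` is
        -- still too large always precedes the one that treats it.
        M = proj₁ (archimedean (ℓ ⁻¹))
        bound : ∀ p q → + suc M ℤ.≤ q → Coprime p q → δ / fromℤ q ^ 2 ≤ ∣ (x - r i) - fromℤ p / fromℤ q ∣
        bound p q@(+ n) (ℤ.+≤+ M<n) _ = ≤-trans
          (/-≤ (^-pos 0<Q 2) (≤-respˡ-≈ (*-identityʳ δ) (≤-respʳ-≈
              (solve 3 (λ z0 δ Q →
                  δ :* (Q :* Q :* z0) :=
                  δ :* z0 :* (Q :* (Q :* (con (+ 1))))) refl
                (len (time i k)) δ Q) (*-monoʳ-≤ δ (<⇒≤ 0<δ) (≮⇒≥ (proj₁ (proj₂ crossing)))))))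
          (≤-trans (≤-reflexive (sym (next-radius i k))) (distance i (suc k) p q 0<Q (proj₂ (proj₂ crossing))))
          where
          Q = fromℤ q
          Late : ℕ → Set
          Late n = Q * Q * len (time i n) < 1#
          1≤Q : 1# ≤ Q
          1≤Q = ≤-trans (1≤fromℕ M) (fromℕ-mono-≤ M<n)
          0<Q : 0# < Q
          0<Q = <-≤-trans 0<1 1≤Q
          not-at-start : ¬ Late 0
          not-at-start late = <⇒≱ late (begin
            1#                         ≈⟨ trans (*-comm _ _) (inverseʳ (0<len (toℕ i))) ⟨
            ℓ ⁻¹ * ℓ
              ≤⟨ *-monoˡ-≤ ℓ (<⇒≤ (0<len (toℕ i))) (≤-trans (<⇒≤ (proj₂ (archimedean (ℓ ⁻¹))))
                (fromℕ-mono-≤ (ℕ.<⇒≤ M<n))) ⟩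
            Q * ℓ                      ≈⟨ *-congʳ (*-identityˡ Q) ⟨
            1# * Q * ℓ                 ≤⟨ *-monoˡ-≤ ℓ (<⇒≤ (0<len (toℕ i))) (*-monoˡ-≤ Q (<⇒≤ 0<Q) 1≤Q) ⟩
            Q * Q * ℓ                  ≈⟨ *-congˡ (reflexive (≡.cong len (≡.sym (ℕ.+-identityʳ (toℕ i))))) ⟩
            Q * Q * len (time i 0)     ∎)
          crossing : ∃[ k ] ¬ Late k × Late (suc k)
          crossing = first-crossing Late not-at-start {proj₁ (eventually-treated i q)} (proj₂ (eventually-treated i q))
          k = proj₁ crossing

      limit-in-translates : ∀ i → (Bad δ ⊕ r i) x
      limit-in-translates i = x - r i , limit-bad i , (solve 2 (λ z0 x → x := x :- z0 :+ z0) refl (r i) x)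

    -- The proportion of nodes that meet a set

    Hit : Subset → ℕ → Carrier → Set
    Hit U k a = ∃[ x ] x ∈ U × a ≤ x × x ≤ a + len k

    0<m : 0# < fromℕ m
    0<m = <-≤-trans 0<1 (≤-respˡ-≈ fromℕ-1 (fromℕ-mono-≤ 1≤m))

    -- The proportion, among the descendants e levels below the node a at depth k,
    -- of those that meet U, as mass U (suc e) k a; and 0 as mass U 0 k a.
    mass : Subset → ℕ → ℕ → Carrier → Carrier
    mass U zero          k a = 0#
    mass U (suc zero)    k a = indicator (Hit U k a)
    mass U (suc (suc e)) k a = fromℕ m ⁻¹ * partialSum (λ j → mass U (suc e) (suc k) (child k a j)) m

    mass-nonNeg : ∀ U c k a → 0# ≤ mass U c k a
    mass-nonNeg U zero          k a = ≤-refl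
    mass-nonNeg U (suc zero)    k a = indicator-nonNeg _
    mass-nonNeg U (suc (suc e)) k a =
      *-nonNeg (<⇒≤ (⁻¹-pos 0<m)) (partialSum-nonNeg (λ j → mass-nonNeg U (suc e) (suc k) (child k a j)) m)

    m*ι* : ∀ s → fromℕ m * (fromℕ m ⁻¹ * s) ≈ s
    m*ι* s = trans (sym (*-assoc _ _ s)) (trans (*-congʳ (inverseʳ 0<m)) (*-identityˡ s))

    -- An equality as long as the set is still measured at a lower depth. At its own depth the
    -- children carry weight 0, which leaves an inequality.
    mass-children : ∀ U c k a → partialSum (λ j → mass U (ℕ.pred c) (suc k) (child k a j)) m ≤ fromℕ m * mass U c k a
    mass-children U zero          k a = ≤-trans (≤-reflexive (partialSum-zero m)) (*-nonNeg (<⇒≤ 0<m) ≤-refl)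
      where
      partialSum-zero : ∀ n → partialSum (λ _ → 0#) n ≈ 0#
      partialSum-zero n =
        trans (partialSum-cong (λ _ → sym (zeroˡ 0#)) n) (trans (partialSum-* 0# (λ _ → 0#) n) (zeroˡ _))
    mass-children U (suc zero)    k a =
      ≤-trans (mass-children U 0 k a) (*-monoʳ-≤ (fromℕ m) (<⇒≤ 0<m) (indicator-nonNeg _))
    mass-children U (suc (suc e)) k a = ≤-reflexive (sym (m*ι* _))

    -- Listed from left to right, so that the nodes meeting a narrow set can be counted in one pass.
    leaves : ℕ → ℕ → Carrier → List Carrier
    leaves zero    k a = a ∷ []
    leaves (suc e) k a = concat (applyUpTo (λ j → leaves e (suc k) (child k a j)) m)

    leaves-inside : ∀ e k a {d} → k ℕ.+ e ≡ d → All (λ b → a ≤ b × b + len d ≤ a + len k) (leaves e k a)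
    leaves-inside zero    k a k+0≡d rewrite ≡.trans (≡.sym k+0≡d) (ℕ.+-identityʳ k) = (≤-refl , ≤-refl) ∷ []
    leaves-inside (suc e) k a k+1+e≡d = All.concat⁺ (All.applyUpTo⁺₁ _ m λ {j} j<m →
      All.map (λ (low , high) → ≤-trans (child-lower k a j) low , ≤-trans high (child-upper k a j<m))
        (leaves-inside e (suc k) (child k a j) (≡.trans (≡.sym (ℕ.+-suc k e)) k+1+e≡d)))

    leaves-spaced : ∀ e k a {d} → k ℕ.+ e ≡ d → AllPairs (λ b c → b + len d ≤ c) (leaves e k a)
    leaves-spaced zero    k a _ = [] ∷ []
    leaves-spaced (suc e) k a {d} k+1+e≡d = AllPairs.concat⁺
      (All.applyUpTo⁺₁ _ m λ {j} _ → leaves-spaced e (suc k) (child k a j) depth)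
      (AllPairs.applyUpTo⁺₁ _ m λ {i} {j} i<j _ →
        All.map (λ (_ , high) → All.map (λ (low , _) → ≤-trans high (≤-trans (child-spaced k a i<j) low))
          (leaves-inside e (suc k) (child k a j) depth))
          (leaves-inside e (suc k) (child k a i) depth))
      where
      depth : suc k ℕ.+ e ≡ d
      depth = ≡.trans (≡.sym (ℕ.+-suc k e)) k+1+e≡d

    count : Subset → ℕ → List Carrier → Carrier
    count U d []       = 0#
    count U d (b ∷ bs) = indicator (Hit U d b) + count U d bs

    count-++ : ∀ U d bs cs → count U d (bs ++ cs) ≈ count U d bs + count U d cs
    count-++ U d []       cs = sym (+-identityˡ _)
    count-++ U d (b ∷ bs) cs = trans (+-congˡ (count-++ U d bs cs)) (sym (+-assoc _ _ _))

    count-concat : ∀ U d f n → count U d (concat (applyUpTo f n)) ≈ partialSum (λ j → count U d (f j)) n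
    count-concat U d f zero    = refl
    count-concat U d f (suc n) = trans (count-++ U d (f 0) _) (+-congˡ (count-concat U d (f ∘ suc) n))

    mass-count : ∀ U e k a {d} → k ℕ.+ e ≡ d → fromℕ m ^ e * mass U (suc e) k a ≈ count U d (leaves e k a)
    mass-count U zero    k a k+0≡d rewrite ≡.trans (≡.sym k+0≡d) (ℕ.+-identityʳ k) =
      trans (*-identityˡ _) (sym (+-identityʳ _))
    mass-count U (suc e) k a {d} k+1+e≡d = begin-equality
      M * M ^ e * (M ⁻¹ * s)                                            ≈⟨
          (solve 4 (λ z0 z1 M s →
              M :* z0 :* (z1 :* s) :=
              z0 :* (M :* (z1 :* s))) refl
            (M ^ e) (M ⁻¹) M s) ⟩
      M ^ e * (M * (M ⁻¹ * s))                                          ≈⟨ *-congˡ (m*ι* s) ⟩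
      M ^ e * s
        ≈⟨ partialSum-* (M ^ e) (λ j → mass U (suc e) (suc k) (child k a j)) m ⟨
      partialSum (λ j → M ^ e * mass U (suc e) (suc k) (child k a j)) m
        ≈⟨ partialSum-cong (λ j → mass-count U e (suc k) (child k a j) (≡.trans (≡.sym (ℕ.+-suc k e)) k+1+e≡d)) m ⟩
      partialSum (λ j → count U d (leaves e (suc k) (child k a j))) m
        ≈⟨ count-concat U d (λ j → leaves e (suc k) (child k a j)) m ⟨
      count U d (leaves (suc e) k a)                                    ∎
      where
      M = fromℕ m
      s = partialSum (λ j → mass U (suc e) (suc k) (child k a j)) m

    -- Strict, because two points at distance exactly `len d` can touch three closed intervals laid
    -- end to end.
    Narrow : Subset → ℕ → Set
    Narrow U d = ∀ {x y} → x ∈ U → y ∈ U → x < y + len d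

    count-none : ∀ {U d bs} → All (¬_ ∘ Hit U d) bs → count U d bs ≈ 0#
    count-none []            = refl
    count-none (¬hit ∷ none) = trans (+-cong (indicator-no ¬hit) (count-none none)) (+-identityˡ 0#)

    -- All intervals after the first one met begin at least `len d` to the right of `x`, out of
    -- reach of a narrow set that contains `x`.
    count≤1 : ∀ {U d x bs} → Narrow U d → x ∈ U → AllPairs (λ b c → b + len d ≤ c) bs → All (x ≤_) bs →
      count U d bs ≤ 1#
    count≤1 narrow x∈U [] [] = 0≤1
    count≤1 {U} {d} {x} {b ∷ bs} narrow x∈U (b≪bs ∷ spaced) (x≤b ∷ x≤bs) = split (lem {P = Hit U d b})
      where
      split : Dec (Hit U d b) → indicator (Hit U d b) + count U d bs ≤ 1#
      split (no ¬hit) =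
        ≤-respˡ-≈ (sym (trans (+-congʳ (indicator-no ¬hit)) (+-identityˡ _))) (count≤1 narrow x∈U spaced x≤bs)
      split (yes hit) =
        ≤-reflexive (trans (+-cong (indicator-yes hit) (count-none (All.map (λ b+ℓ≤c → λ (z , z∈U , c≤z , _) →
        <⇒≱ (narrow z∈U x∈U) (≤-trans (+-monoˡ-≤ (len d) x≤b) (≤-trans b+ℓ≤c c≤z))) b≪bs))) (+-identityʳ 1#))

    -- A point of the set in the first interval met lies to the left of all later ones, so `count≤1`
    -- applies to these.
    count≤2 : ∀ {U d bs} → Narrow U d → AllPairs (λ b c → b + len d ≤ c) bs → count U d bs ≤ 1# + 1#
    count≤2 narrow [] = <⇒≤ 0<2
    count≤2 {U} {d} {b ∷ bs} narrow (b≪bs ∷ spaced) = split (lem {P = Hit U d b})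
      where
      split : Dec (Hit U d b) → indicator (Hit U d b) + count U d bs ≤ 1# + 1#
      split (no ¬hit) = ≤-respˡ-≈ (sym (trans (+-congʳ (indicator-no ¬hit)) (+-identityˡ _))) (count≤2 narrow spaced)
      split (yes hit@(x , x∈U , _ , x≤b+ℓ)) =
        ≤-reflexive (indicator-yes hit) ⊹ count≤1 narrow x∈U spaced (All.map (≤-trans x≤b+ℓ) b≪bs)

    mass-bound : ∀ {U d} → Narrow U d → ∀ a → fromℕ m ^ d * mass U (suc d) 0 a ≤ 1# + 1#
    mass-bound {U} {d} narrow a =
      ≤-respˡ-≈ (sym (mass-count U d 0 a ≡.refl)) (count≤2 narrow (leaves-spaced d 0 a ≡.refl))

    -- Escaping a countable family of sets

    module _ (U : ℕ → Subset) (D : ℕ → ℕ) where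

      -- Zero as soon as k exceeds D n, by truncated subtraction.
      weight : ℕ → ℕ → Carrier → Carrier
      weight n k a = mass (U n) (suc (D n) ℕ.∸ k) k a

      weight-nonNeg : ∀ k a n → 0# ≤ weight n k a
      weight-nonNeg k a n = mass-nonNeg (U n) (suc (D n) ℕ.∸ k) k a

      -- Stated by partial sums, so that a failure is witnessed by finitely many of the sets.
      Good : ℕ → Carrier → Set
      Good k a = ∀ J → partialSum (λ n → weight n k a) J < 1#

      weight-children : ∀ k a n → partialSum (λ j → weight n (suc k) (child k a j)) m ≤ fromℕ m * weight n k a
      weight-children k a n =
        ≡.subst (λ c → partialSum (λ j → mass (U n) c (suc k) (child k a j)) m ≤ fromℕ m * weight n k a)
        (ℕ.pred[m∸n]≡m∸[1+n] (suc (D n)) k) (mass-children (U n) (suc (D n) ℕ.∸ k) k a)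

      -- If every child failed, partial sums of one common length would be at least 1 at each of the
      -- `m` children, hence at least `m` in total. By averaging, the total is at most `m` times the
      -- partial sum at the parent, which is less than `m`.
      good-child : ∀ {k a} → Good k a → ∃[ j ] j ℕ.< m × Good (suc k) (child k a j)
      good-child {k} {a} good = decide (lem {P = ∃[ j ] j ℕ.< m × Good (suc k) (child k a j)})
        where
        Heavy : ℕ → ℕ → Set
        Heavy j J = 1# ≤ partialSum (λ n → weight n (suc k) (child k a j)) J
        heavy : ∀ {j} → ¬ Good (suc k) (child k a j) → ∃ (Heavy j)
        heavy {j} bad = search (lem {P = ∃ (Heavy j)})
          where
          search : Dec (∃ (Heavy j)) → ∃ (Heavy j)
          search (yes found) = found
          search (no none)   = ⊥-elim (bad λ J → ≰⇒> λ 1≤sum → none (J , 1≤sum))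
        overweight : (∃[ J ] (∀ j → j ℕ.< m → Heavy j J)) → ⊥
        overweight (J , all-heavy) = <-irrefl (begin-strict
          fromℕ m
            ≤⟨ count≤partialSum m all-heavy ⟩
          partialSum (λ j → partialSum (λ n → weight n (suc k) (child k a j)) J) m
            ≈⟨ partialSum-swap (λ j n → weight n (suc k) (child k a j)) m J ⟩
          partialSum (λ n → partialSum (λ j → weight n (suc k) (child k a j)) m) J
            ≤⟨ partialSum-mono (weight-children k a) J ⟩
          partialSum (λ n → fromℕ m * weight n k a) J
            ≈⟨ partialSum-* (fromℕ m) (λ n → weight n k a) J ⟩
          fromℕ m * partialSum (λ n → weight n k a) J
            <⟨ *-monoʳ-< (fromℕ m) 0<m (good J) ⟩
          fromℕ m * 1#                                                                        ≈⟨ *-identityʳ _ ⟩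
          fromℕ m                                                                             ∎)
        decide : Dec (∃[ j ] j ℕ.< m × Good (suc k) (child k a j)) → ∃[ j ] j ℕ.< m × Good (suc k) (child k a j)
        decide (yes found) = found
        decide (no none) = ⊥-elim (overweight (common-bound {Heavy} (λ {j} J≤J′ 1≤sum → ≤-trans 1≤sum (partialSum-mono-index (weight-nonNeg (suc k) (child k a j)) J≤J′)) m
          λ j j<m → heavy {j} λ good′ → none (j , j<m , good′)))

      good-path : ∀ {a₀} → Good 0 a₀ → ∃[ a ] Path a × (∀ k → Good k (a k))
      good-path {a₀} good₀ = (λ k → proj₁ (node k)) , path , (λ k → proj₂ (node k))
        where
        next : ∃[ k ] ∃ (Good k) → Carrier
        next (k , a , good) = child k a (proj₁ (good-child {k} {a} good))
        node : ∀ k → ∃ (Good k)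
        node zero    = a₀ , good₀
        node (suc k) = next (k , node k) , proj₂ (proj₂ (good-child {k} {proj₁ (node k)} (proj₂ (node k))))
        path : Path (λ k → proj₁ (node k))
        path k = proj₁ chosen , proj₁ (proj₂ chosen) , ≡.refl
          where
          chosen = good-child {k} {proj₁ (node k)} (proj₂ (node k))

      -- At depth `D n` the node of the path contains `x`; if `U n` does too, its weight there is a
      -- full 1, and this single term refutes `Good`.
      good-avoids : ∀ {a x} → (∀ k → Good k (a k)) → InAll a x → ∀ n → ¬ x ∈ U n
      good-avoids {a} {x} good inAll n x∈Uₙ = <⇒≱ (good d (suc n))
        (≤-trans (≤-reflexive (sym hit)) (term≤partialSum (weight-nonNeg d (a d)) n))
        where
        d = D n
        hit : weight n d (a d) ≈ 1#
        hit = ≡.subst (λ c → mass (U n) c d (a d) ≈ 1#) (≡.sym (ℕ.m+n∸n≡m 1 d)) (indicator-yes (x , x∈Uₙ , inAll d))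

      survivor : ∀ {a₀} → Good 0 a₀ → ∃[ a ] ∃[ x ] Path a × InAll a x × (∀ n → ¬ x ∈ U n)
      survivor good₀ = conclude (good-path good₀)
        where
        conclude : (∃[ a ] Path a × (∀ k → Good k (a k))) → ∃[ a ] ∃[ x ] Path a × InAll a x × (∀ n → ¬ x ∈ U n)
        conclude (a , path , good) = let (x , inAll) = path-limit path in a , x , path , inAll , good-avoids good inAll

    -- A lower bound for the cost of covers

    module _ (2≤m : 2 ℕ.≤ m) (6u₀≈1 : six u₀ ≈ 1#) (t : Carrier)
      (power-bound : ∀ {d} k → γ ^ k ≤ d → (fromℕ m ⁻¹) ^ k ≤ d ^ʳ t) where

      private
        M = fromℕ m
        ι = M ⁻¹

      0<ι : 0# < ι
      0<ι = ⁻¹-pos 0<m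

      ι≤½ : ι ≤ ½
      ι≤½ = *-cancelʳ-≤ M 0<m (begin
        ι * M               ≈⟨ trans (*-comm ι M) (inverseʳ 0<m) ⟩
        1#                  ≈⟨ trans (*-comm ½ _) (inverseʳ 0<2) ⟨
        ½ * (1# + 1#)
          ≤⟨ *-monoʳ-≤ ½ (<⇒≤ 0<½) (≤-respˡ-≈(solve 0
            ((con (+ 1)) :+ ((con (+ 1)) :+ (con (+ 0))) := (con (+ 1)) :+ (con (+ 1))) refl) (fromℕ-mono-≤ 2≤m)) ⟩
        ½ * M               ∎)

      len≈γ^ : ∀ k → len k ≈ γ ^ k
      len≈γ^ k = trans
          (solve 2 (λ u₀ g →
              (u₀ :* g :+ u₀ :* g) :+ (u₀ :* g :+ u₀ :* g) :+ (u₀ :* g :+ u₀ :* g) :=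
              ((u₀ :+ u₀) :+ (u₀ :+ u₀) :+ (u₀ :+ u₀)) :* g) refl
            u₀ g) (trans (*-congʳ 6u₀≈1) (*-identityˡ g))
        where
        g = γ ^ k

      reciprocal-power : ∀ k → ι ^ k * M ^ k ≈ 1#
      reciprocal-power zero    = *-identityˡ 1#
      reciprocal-power (suc k) = trans
          (solve 4 (λ z0 z1 ι M →
              ι :* z0 :* (M :* z1) :=
              (M :* ι) :* (z0 :* z1)) refl
            (ι ^ k) (M ^ k) ι M)
        (trans (*-cong (inverseʳ 0<m) (reciprocal-power k)) (*-identityˡ 1#))

      mass-≤ : ∀ {U d} → Narrow U d → ∀ a → mass U (suc d) 0 a ≤ (1# + 1#) * ι ^ d
      mass-≤ {U} {d} narrow a = ≤-respˡ-≈ (begin-equality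
          ι ^ d * (M ^ d * μ)     ≈⟨ *-assoc _ _ _ ⟨
          ι ^ d * M ^ d * μ       ≈⟨ *-congʳ (reciprocal-power d) ⟩
          1# * μ                  ≈⟨ *-identityˡ μ ⟩
          μ                       ∎)
        (≤-respʳ-≈ (*-comm _ _) (*-monoʳ-≤ (ι ^ d) (^-nonNeg (<⇒≤ 0<ι) d) (mass-bound {U} {d} narrow a)))
        where
        μ = mass U (suc d) 0 a

      -- A depth at which the `n`th set of a cover may be measured. The geometric summand pays for
      -- empty sets and single points, whose `diamPower` may be zero; over all `n` it adds up to
      -- `½`.
      Fit : Subset → ℕ → ℕ → Set
      Fit U n d = Narrow U d × (1# + 1#) * ι ^ d ≤ (1# + 1#) * M * diamPower t U + ½ ^ suc (suc n)

      -- The exponent of the depth exceeds that of the geometric summand by one, which absorbs the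
      -- factor 2; `m ≥ 2` enters through `ι≤½`.
      fit-deep : ∀ {U} n → Narrow U (suc (suc (suc n))) → Fit U n (suc (suc (suc n)))
      fit-deep {U} n narrow = narrow , (begin
        (1# + 1#) * ι ^ d                   ≤⟨ *-monoʳ-≤ _ (<⇒≤ 0<2) (^-monoˡ-≤ (<⇒≤ 0<ι) ι≤½ d) ⟩
        (1# + 1#) * ½ ^ d                   ≈⟨
            (solve 1 (λ z0 →
                ((con (+ 1)) :+ (con (+ 1))) :* z0 :=
                z0 :+ z0) refl
              (½ ^ d)) ⟩
        ½ ^ d + ½ ^ d                       ≈⟨ half-power (suc (suc n)) ⟩
        ½ ^ suc (suc n)
          ≤⟨ x≤x+y _ (*-nonNeg (*-nonNeg (<⇒≤ 0<2) (<⇒≤ 0<m)) (diamPower-nonNeg U t)) ⟩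
        ½ ^ suc (suc n) + (1# + 1#) * M * diamPower t U     ≈⟨ +-comm _ _ ⟩
        (1# + 1#) * M * diamPower t U + ½ ^ suc (suc n)     ∎)
        where
        d = suc (suc (suc n))

      -- The depth `k` is taken with `γ^(k+1) ≤ diam U < γ^k`. The right inequality makes `U`
      -- narrow, the left one bounds `ι^(k+1)` by the power of the diameter, and the difference of
      -- one level costs the factor `M`.
      fit-positive : ∀ {U} n → Satisfiable U → DiamAtMost ½ U → 0# < diam U → ∃ (Fit U n)
      fit-positive {U} n inhabited small 0<s =
        -- The fineness `½` guarantees that the diameter is below `γ^0 = 1`, so the crossing starts
        -- from a failure.
        fit (first-crossing (λ k → γ ^ k ≤ s) (<⇒≱ (≤-<-trans (diam≤ inhabited small) ½<1)) {K} γᴷ≤s)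
        where
        s = diam U
        vanishing = power-vanishes 0<γ 2γ≤1 (s ⁻¹)
        K = proj₁ vanishing
        γᴷ≤s : γ ^ K ≤ s
        γᴷ≤s = begin
          γ ^ K                  ≈⟨ trans (*-congʳ (inverseʳ 0<s)) (*-identityˡ _) ⟨
          s * s ⁻¹ * γ ^ K       ≈⟨ *-assoc _ _ _ ⟩
          s * (s ⁻¹ * γ ^ K)     ≤⟨ *-monoʳ-≤ s (<⇒≤ 0<s) (<⇒≤ (proj₂ vanishing K ℕ.≤-refl)) ⟩
          s * 1#                 ≈⟨ *-identityʳ s ⟩
          s                      ∎
        fit : (∃[ k ] (¬ γ ^ k ≤ s) × γ ^ suc k ≤ s) → ∃ (Fit U n)
        fit (k , γᵏ≰s , γᵏ⁺¹≤s) = k , narrow , (begin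
          (1# + 1#) * ι ^ k                       ≈⟨ *-congˡ (trans (*-congʳ (inverseʳ 0<m)) (*-identityˡ _)) ⟨
          (1# + 1#) * (M * ι * ι ^ k)             ≈⟨
              (solve 3 (λ z0 M ι →
                  ((con (+ 1)) :+ (con (+ 1))) :* (M :* ι :* z0) :=
                  ((con (+ 1)) :+ (con (+ 1))) :* M :* (ι :* z0)) refl
                (ι ^ k) M ι) ⟩
          (1# + 1#) * M * ι ^ suc k
            ≤⟨ *-monoʳ-≤ _ (*-nonNeg (<⇒≤ 0<2) (<⇒≤ 0<m)) (power-bound (suc k) γᵏ⁺¹≤s) ⟩
          (1# + 1#) * M * s ^ʳ t                  ≈⟨ *-congˡ (diamPower-inhabited t inhabited) ⟨
          (1# + 1#) * M * diamPower t U           ≤⟨ x≤x+y _ (^-nonNeg (<⇒≤ 0<½) (suc (suc n))) ⟩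
          (1# + 1#) * M * diamPower t U + ½ ^ suc (suc n)     ∎)
          where
          narrow : Narrow U k
          narrow {x} {y} x∈U y∈U =
            <-cancel (<-respʳ (sym (len≈γ^ k)) (≤-<-trans (difference≤diam small x∈U y∈U) (≰⇒> γᵏ≰s)))
            (solve 3 (λ z0 y x → y :+ z0 :+ (x :- y) := x :+ z0) refl (len k) y x)

      fit : ∀ U n → DiamAtMost ½ U → ∃ (Fit U n)
      fit U n small = by-emptiness (lem {P = Satisfiable U})
        where
        d = suc (suc (suc n))
        by-diameter : Satisfiable U → diam U ≤ 0# ⊎ 0# < diam U → ∃ (Fit U n)
        by-diameter inhabited (inj₁ s≤0) = d , fit-deep n λ {x} {y} x∈U y∈U →
          <-cancel (≤-<-trans (≤-trans (difference≤diam small x∈U y∈U) s≤0) (0<len d))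
              (solve 3 (λ z0 y x →
                  y :+ z0 :+ (x :- y) :=
                  x :+ z0) refl
                (len d) y x)
        by-diameter inhabited (inj₂ 0<s) = fit-positive n inhabited small 0<s
        by-emptiness : Dec (Satisfiable U) → ∃ (Fit U n)
        by-emptiness (yes inhabited) = by-diameter inhabited (≤∨> (diam U) 0#)
        by-emptiness (no empty)      = d , fit-deep n λ {x} x∈U _ → ⊥-elim (empty (x , x∈U))

      half-series : ∀ J → partialSum (λ n → ½ ^ suc (suc n)) J < ½
      half-series J = <-respʳ (total-mass J) (x<x+y _ (^-pos 0<½ (suc J)))
        where
        total-mass : ∀ J → partialSum (λ n → ½ ^ suc (suc n)) J + ½ ^ suc J ≈ ½
        total-mass zero    = trans (+-identityˡ _) (*-identityʳ ½)
        total-mass (suc J) = begin-equality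
          partialSum (λ n → ½ ^ suc (suc n)) (suc J) + ½ ^ suc (suc J)
            ≈⟨ +-congʳ (partialSum-last (λ n → ½ ^ suc (suc n)) J) ⟩
          partialSum (λ n → ½ ^ suc (suc n)) J + ½ ^ suc (suc J) + ½ ^ suc (suc J)        ≈⟨ +-assoc _ _ _ ⟩
          partialSum (λ n → ½ ^ suc (suc n)) J + (½ ^ suc (suc J) + ½ ^ suc (suc J))
            ≈⟨ +-congˡ (half-power (suc J)) ⟩
          partialSum (λ n → ½ ^ suc (suc n)) J + ½ ^ suc J                                ≈⟨ total-mass J ⟩
          ½                                                                              ∎

      -- This is `1 / (4 m)`: the factor `2 m` in `Fit` turns it into `½`, and the other `½` is
      -- reserved for the geometric summands.
      cover-cost : Carrier
      cover-cost = ½ * (½ * ι)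

      0<cover-cost : 0# < cover-cost
      0<cover-cost = *-pos 0<½ (*-pos 0<½ 0<ι)

      cover-≥ : ∀ {E} → (∀ {a x} → Path a → InAll a x → x ∈ E) → (C : Cover ½ E) →
        [ cover-cost ] ≤∞ Σ∞ (λ n → diamPower t (Cover.part C n))
      cover-≥ {E} limits∈E C = decide (lem {P = [ cover-cost ] ≤∞ Σ∞ f})
        where
        open Cover C
        f : ℕ → Carrier
        f n = diamPower t (part n)
        depth : ∀ n → ∃ (Fit (part n) n)
        depth n = fit (part n) n (fine n)
        D : ℕ → ℕ
        D n = proj₁ (depth n)
        b : ℕ → Carrier
        b n = (1# + 1#) * M * f n + ½ ^ suc (suc n)
        total-cost : (∀ J → partialSum f J < cover-cost) → ∀ J → partialSum b J < 1#
        total-cost cheap J = begin-strict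
          partialSum b J
            ≈⟨ partialSum-+ (λ n → (1# + 1#) * M * f n) (λ n → ½ ^ suc (suc n)) J ⟩
          partialSum (λ n → (1# + 1#) * M * f n) J + partialSum (λ n → ½ ^ suc (suc n)) J
            ≈⟨ +-congʳ (partialSum-* ((1# + 1#) * M) f J) ⟩
          (1# + 1#) * M * partialSum f J + partialSum (λ n → ½ ^ suc (suc n)) J
            <⟨ *-monoʳ-≤ _ (*-nonNeg (<⇒≤ 0<2) (<⇒≤ 0<m)) (<⇒≤ (cheap J)) ⊹< half-series J ⟩
          (1# + 1#) * M * (½ * (½ * ι)) + ½                                           ≈⟨
              (solve 3 (λ M ½ ι →
                  ((con (+ 1)) :+ (con (+ 1))) :* M :* (½ :* (½ :* ι)) :+ ½ :=
                  (½ :* ½ :+ ½ :* ½) :* (M :* ι) :+ ½) refl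
                M ½ ι) ⟩
          (½ * ½ + ½ * ½) * (M * ι) + ½
            ≈⟨ +-congʳ (trans (*-cong (half-sum ½) (inverseʳ 0<m)) (*-identityʳ ½)) ⟩
          ½ + ½
            ≈⟨ trans (+-cong (sym (*-identityˡ ½)) (sym (*-identityˡ ½))) (half-sum 1#) ⟩
          1#                                                                          ∎
        good : (∀ J → partialSum f J < cover-cost) → Good part D 0 0#
        good cheap J = ≤-<-trans (partialSum-mono weight-≤ J) (total-cost cheap J)
          where
          weight-≤ : ∀ n → mass (part n) (suc (D n)) 0 0# ≤ b n
          weight-≤ n = ≤-trans (mass-≤ {part n} {D n} (proj₁ (proj₂ (depth n))) 0#) (proj₂ (proj₂ (depth n)))
        escape : (∃[ a ] ∃[ x ] Path a × InAll a x × (∀ n → ¬ x ∈ part n)) → ⊥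
        escape (a , x , path , inAll , uncovered) = let (n , x∈Uₙ) = covers (limits∈E path inAll) in uncovered n x∈Uₙ
        decide : Dec ([ cover-cost ] ≤∞ Σ∞ f) → [ cover-cost ] ≤∞ Σ∞ f
        decide (yes bound) = bound
        decide (no cheap)  = ⊥-elim (escape (survivor part D (good (Σ∞-< {f} cheap))))

  -- Numerical lemmas on roots, floors and logarithms

  6u+u : ∀ x → six (x / fromℕ 7) + x / fromℕ 7 ≈ x
  6u+u x = trans
      (solve 1 (λ v →
          (v :+ v) :+ (v :+ v) :+ (v :+ v) :+ v :=
          v :* ((con (+ 1)) :+ ((con (+ 1)) :+ ((con (+ 1)) :+
            ((con (+ 1)) :+ ((con (+ 1)) :+ ((con (+ 1)) :+ ((con (+ 1)) :+ (con (+ 0)))))))))) refl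
        v) (/-*-cancel (0<fromℕ 7))
    where
    v = x / fromℕ 7

  fromℕ-6 : ∀ x → fromℕ 6 * x ≈ six x
  fromℕ-6 x =
      (solve 1 (λ x →
          ((con (+ 1)) :+ ((con (+ 1)) :+ ((con (+ 1)) :+
            ((con (+ 1)) :+ ((con (+ 1)) :+ ((con (+ 1)) :+ (con (+ 0)))))))) :* x :=
          (x :+ x) :+ (x :+ x) :+ (x :+ x)) refl
        x)

  ^ℤ-pred : ∀ x N′ → x ^ℤ (+ suc N′ ℤ.- 1ℤ) ≈ x ^ N′
  ^ℤ-pred x N′ = reflexive (≡.cong (x ^ℤ_) (ℤ.[1+m]⊖[1+n]≡m⊖n N′ 0))

  ^ℤ-neg-pred : ∀ {x} → 0# < x → ∀ N′ → x ^ℤ (1ℤ ℤ.- + suc N′) * x ^ N′ ≈ 1#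
  ^ℤ-neg-pred {x} 0<x N′ = trans (*-congʳ (reflexive (≡.cong (x ^ℤ_) (ℤ.[1+m]⊖[1+n]≡m⊖n 0 N′)))) (cancel N′)
    where
    cancel : ∀ n → x ^ℤ (0 ℤ.⊖ n) * x ^ n ≈ 1#
    cancel zero    = *-identityˡ 1#
    cancel (suc n) = trans (*-comm _ _) (inverseʳ (^-pos 0<x (suc n)))

  ^-≤1-cancel : ∀ {x} n → x ^ suc n ≤ 1# → x ≤ 1#
  ^-≤1-cancel n xⁿ≤1 = ≮⇒≥ λ 1<x → <⇒≱ (1<^ 1<x n) xⁿ≤1

  integer-part≥1 : ∀ {x} → 1# ≤ x → ∀ i → fromℤ i ≤ x × x < fromℤ i + 1# → ∃[ n ] i ≡ + suc n × fromℕ (suc n) ≤ x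
  integer-part≥1 1≤x (+ suc n) (n≤x , _)  = n , ≡.refl , n≤x
  integer-part≥1 1≤x (+ 0)     (_ , x<1)  = ⊥-elim (<⇒≱ x<1 (≤-trans (≤-reflexive (+-identityˡ 1#)) 1≤x))
  integer-part≥1 1≤x -[1+ n ]  (_ , x<-n) = ⊥-elim (<⇒≱ x<-n (≤-trans (≤-cancel (0≤fromℕ (suc n))
      (solve 1 (λ z0 →
          (con (+ 1)) :+ (con (+ 0)) :=
          :- z0 :+ (con (+ 1)) :+ z0) refl
        (fromℕ (suc n)))) 1≤x))

  floor≥1 : ∀ {x} → 1# ≤ x → ∃[ n ] ⌊ x ⌋ ≡ + suc n × fromℕ (suc n) ≤ x
  floor≥1 {x} 1≤x = integer-part≥1 1≤x ⌊ x ⌋ (floor-satisfies (≤-trans 0≤1 1≤x))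

  0<log : ∀ {x} → 1# < x → 0# < log x
  0<log {x} 1<x =
    ≰⇒> λ log≤0 → <⇒≱ 1<x (≤-trans (≤-reflexive (sym (exp-log (<-trans 0<1 1<x))))
      (≤-trans (exp-mono-≤ log≤0) (≤-reflexive exp-0)))

  1<1/x : ∀ {x} → 0# < x → x < 1# → 1# < 1# / x
  1<1/x {x} 0<x x<1 = *-cancelʳ-< x (<⇒≤ 0<x) (<-respˡ (sym (*-identityˡ x)) (<-respʳ (sym (/-*-cancel 0<x)) x<1))

  exp-root : ∀ n x → exp (x / fromℕ (suc n)) ^ suc n ≈ exp x
  exp-root n x =
    trans (sym (exp-fromℕ (suc n) (x / fromℕ (suc n)))) (exp-cong (trans (*-comm _ _) (/-*-cancel (0<fromℕ (suc n)))))

  -- The constants of the theorem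

  module Constants (N′ : ℕ) (δ : Carrier) (0<δ : 0# < δ) (δ<bound : δ < fromℕ 3 ^ℤ (1ℤ ℤ.- + suc N′) / fromℕ 18) where

    private
      N = suc N′
      T = fromℕ 3 ^ N′
      A = fromℕ 18 * δ * fromℕ 3 ^ℤ (+ N ℤ.- 1ℤ)
      B = fromℕ 6 * δ

    0<T : 0# < T
    0<T = ^-pos (0<fromℕ 3) N′

    A≈ : A ≈ fromℕ 18 * δ * T
    A≈ = *-congˡ (^ℤ-pred (fromℕ 3) N′)

    -- The origin of 18 in the statement: it is 3 times 6, so that `A` is the Nth power of 3 times
    -- `6 δ`.
    A≈3B : A ≈ fromℕ 3 * T * B
    A≈3B = trans A≈ (trans (*-congʳ (*-congʳ (fromℕ-* 3 6)))
        (solve 4 (λ z0 z1 δ T →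
            z0 :* z1 :* δ :* T :=
            z0 :* T :* (z1 :* δ)) refl
          (fromℕ 3) (fromℕ 6) δ T))

    0<B : 0# < B
    0<B = *-pos (0<fromℕ 6) 0<δ

    0<A : 0# < A
    0<A = <-respʳ (sym A≈) (*-pos (*-pos (0<fromℕ 18) 0<δ) 0<T)

    A<1 : A < 1#
    A<1 = begin-strict
      A                                                           ≈⟨ A≈ ⟩
      fromℕ 18 * δ * T
        <⟨ *-monoˡ-< T 0<T (*-monoʳ-< (fromℕ 18) (0<fromℕ 18) δ<bound) ⟩
      fromℕ 18 * (fromℕ 3 ^ℤ (1ℤ ℤ.- + N) / fromℕ 18) * T
        ≈⟨ *-congʳ (trans (*-comm _ _) (/-*-cancel (0<fromℕ 18))) ⟩
      fromℕ 3 ^ℤ (1ℤ ℤ.- + N) * T                                 ≈⟨ ^ℤ-neg-pred (0<fromℕ 3) N′ ⟩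
      1#                                                          ∎

    1≤3T : 1# ≤ fromℕ 3 * T
    1≤3T = ≤-respˡ-≈ (*-identityˡ 1#) (*-mono-≤ 0≤1 (1≤fromℕ 2) 0≤1 (1≤^ (1≤fromℕ 2) N′))

    B<1 : B < 1#
    B<1 = ≤-<-trans (≤-respˡ-≈ (*-identityˡ B) (≤-respʳ-≈ (sym A≈3B) (*-monoˡ-≤ B (<⇒≤ 0<B) 1≤3T))) A<1

    Λ : Carrier
    Λ = log (1# / B)

    0<Λ : 0# < Λ
    0<Λ = 0<log (1<1/x 0<B B<1)

    -- Minus the logarithm of `γ`: the Nth root of `6 δ` is taken through `exp`, which also puts it
    -- in the form that `power-≥` expects.
    g : Carrier
    g = Λ / fromℕ N

    γ : Carrier
    γ = exp (- g)

    root : Carrier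
    root = (1# / A) ^ʳ (1# / fromℕ N)

    private
      κ = log (1# / A) / fromℕ N

    root≈exp : root ≈ exp κ
    root≈exp = trans (^ʳ-pos (1# / fromℕ N) (/-pos 0<1 0<A)) (exp-cong
        (solve 2 (λ z0 z1 →
            (con (+ 1)) :* z0 :* z1 :=
            z1 :* z0) refl
          (fromℕ N ⁻¹) (log (1# / A))))

    -- The upper bound on `δ` amounts to `A < 1`; it makes the floor of the root at least 1, so that
    -- every node has a child.
    1≤root : 1# ≤ root
    1≤root = ≤-respˡ-≈ exp-0 (≤-respʳ-≈ (sym root≈exp) (exp-mono-≤ (<⇒≤ (/-pos (0<log (1<1/x 0<A A<1)) (0<fromℕ N)))))

    root^N : root ^ N ≈ 1# / A
    root^N = trans (^-congˡ N root≈exp) (trans (exp-root N′ (log (1# / A))) (exp-log (/-pos 0<1 0<A)))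

    γ^N≈B : γ ^ N ≈ B
    γ^N≈B = *-cancelʳ-≈ (1# / B) (/-pos 0<1 0<B) (begin-equality
      γ ^ N * (1# / B)          ≈⟨ *-cong (^-congˡ N (exp-cong
          (solve 2 (λ z0 Λ →
              :- (Λ :* z0) :=
              :- Λ :* z0) refl
            (fromℕ N ⁻¹) Λ))) (sym (exp-log (/-pos 0<1 0<B))) ⟩
      exp (- Λ / fromℕ N) ^ N * exp Λ   ≈⟨ *-congʳ (exp-root N′ (- Λ)) ⟩
      exp (- Λ) * exp Λ         ≈⟨ exp-neg Λ ⟩
      1#                        ≈⟨ /-*-cancel 0<B ⟨
      1# / B * B                ≈⟨ *-comm _ _ ⟩
      B * (1# / B)              ∎)

    γ^N≈6δ : γ ^ N ≈ six δ
    γ^N≈6δ = trans γ^N≈B (fromℕ-6 δ)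

    -- The Nth power of the left side is exactly 1, as `root ^ N` is `1# / A` and `A` is `3^N` times
    -- `γ ^ N`.
    3γroot≤1 : fromℕ 3 * (root * γ) ≤ 1#
    3γroot≤1 = ^-≤1-cancel N′ (≤-reflexive (begin-equality
      (fromℕ 3 * (root * γ)) ^ N
        ≈⟨ trans (^-distrib-* (fromℕ 3) (root * γ) N) (*-congˡ (^-distrib-* root γ N)) ⟩
      fromℕ 3 * T * (root ^ N * γ ^ N)      ≈⟨ *-congˡ (*-cong root^N γ^N≈B) ⟩
      fromℕ 3 * T * (1# / A * B)            ≈⟨
          (solve 4 (λ z0 z1 T B →
              z0 :* T :* ((con (+ 1)) :* z1 :* B) :=
              z0 :* T :* B :* z1) refl
            (fromℕ 3) (A ⁻¹) T B) ⟩
      fromℕ 3 * T * B * A ⁻¹                ≈⟨ *-congʳ A≈3B ⟨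
      A * A ⁻¹                              ≈⟨ inverseʳ 0<A ⟩
      1#                                    ∎))

    3mγ≤1 : ∀ {m} → fromℕ m ≤ root → (1# + 1# + 1#) * (fromℕ m * γ) ≤ 1#
    3mγ≤1 {m} m≤root = begin
      (1# + 1# + 1#) * (fromℕ m * γ)    ≈⟨
          (solve 1 (λ z0 →
              ((con (+ 1)) :+ (con (+ 1)) :+ (con (+ 1))) :* z0 :=
              ((con (+ 1)) :+ ((con (+ 1)) :+ ((con (+ 1)) :+ (con (+ 0))))) :* z0) refl
            (fromℕ m * γ)) ⟩
      fromℕ 3 * (fromℕ m * γ)           ≤⟨ *-monoʳ-≤ (fromℕ 3) (0≤fromℕ 3) (*-monoˡ-≤ γ (<⇒≤ (exp-pos (- g))) m≤root) ⟩
      fromℕ 3 * (root * γ)              ≤⟨ 3γroot≤1 ⟩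
      1#                                ∎

    -- Density and dimension of the intersection

    module _ (r : Fin N → Carrier) (m′ : ℕ) (m≤root : fromℕ (suc m′) ≤ root) where

      private
        m = suc m′

      E : Subset
      E = ⋂ (Fin N) (λ i → Bad δ ⊕ r i)

      E-dense : Dense E
      E-dense x ε 0<ε = dense (path-limit path)
        where
        -- Makes the length of the root `6ε / 7`, which is strictly less than `ε`.
        u₀ = ε / fromℕ 7
        open Construction r δ γ u₀ m 0<δ (exp-pos (- g)) (/-pos 0<ε (0<fromℕ 7)) (ℕ.s≤s ℕ.z≤n) γ^N≈6δ (3mγ≤1 {m} m≤root)
        -- The root begins at `x`; any path below it would serve, and this one always takes the
        -- leftmost child.
        a : ℕ → Carrier
        a zero    = x
        a (suc k) = child k (a k) 0
        path : Path a
        path k = 0 , ℕ.s≤s ℕ.z≤n , ≡.refl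
        len-0 : len 0 < ε
        len-0 = <-cancel (0<u 0) (trans (+-identityʳ ε) (trans (sym (6u+u ε))
            (solve 1 (λ u₀ →
                (u₀ :+ u₀) :+ (u₀ :+ u₀) :+ (u₀ :+ u₀) :+ u₀ :=
                (u₀ :* (con (+ 1)) :+ u₀ :* (con (+ 1))) :+ (u₀ :* (con (+ 1)) :+ u₀ :* (con (+ 1))) :+
                  (u₀ :* (con (+ 1)) :+ u₀ :* (con (+ 1))) :+ u₀ :* (con (+ 1))) refl
              u₀)))
        dense : (∃[ y ] InAll a y) → ∃[ y ] y ∈ E × ∣ x - y ∣ < ε
        dense (y , inAll) = y , limit-in-translates path inAll , ∣-∣<-intro {x} {y} {ε}
          (≤-<-trans (proj₁ (inAll 0)) (x<x+y y 0<ε))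
          (≤-<-trans (proj₂ (inAll 0)) (<-cancel len-0
              (solve 3 (λ z0 x ε →
                  x :+ ε :+ z0 :=
                  x :+ z0 :+ ε) refl
                (len 0) x ε)))

      E-measure : 2 ℕ.≤ m → ∀ t → 0# ≤ t → t * g ≤ log (fromℕ m) → ¬ hausdorffMeasure t E ≈∞ [ 0# ]
      E-measure 2≤m t 0≤t tg≤logm = measure-positive t E (0<cover-cost 2≤m 6u₀≈1 t power-bound) 0<½
        (cover-≥ 2≤m 6u₀≈1 t power-bound {E} limit-in-translates)
        where
        u₀ = (fromℕ 6) ⁻¹
        6u₀≈1 : six u₀ ≈ 1#
        6u₀≈1 = trans (sym (fromℕ-6 u₀)) (inverseʳ (0<fromℕ 6))
        open Construction r δ γ u₀ m 0<δ (exp-pos (- g)) (⁻¹-pos (0<fromℕ 6)) (ℕ.s≤s ℕ.z≤n) γ^N≈6δ (3mγ≤1 {m} m≤root)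
        power-bound : ∀ {d} k → γ ^ k ≤ d → (fromℕ m ⁻¹) ^ k ≤ d ^ʳ t
        power-bound = power-≥ {t} {g} {fromℕ m} 0≤t (0<fromℕ m) tg≤logm

      -- A `t` below the claimed bound satisfies `t * g ≤ log (fromℕ m)`, and then the mass estimate
      -- keeps the measure away from zero.
      E-exponent : ∀ t → 0# ≤ t → hausdorffMeasure t E ≈∞ [ 0# ] → fromℕ N * log (fromℕ m) / Λ ≤ t
      E-exponent t 0≤t null = /-≤ 0<Λ (≮⇒≥ λ tΛ<N·logm →
        E-measure (2≤m m′ ≡.refl tΛ<N·logm) t 0≤t (tg≤logm tΛ<N·logm) null)
        where
        tg≤logm : t * Λ < fromℕ N * log (fromℕ m) → t * g ≤ log (fromℕ m)
        tg≤logm tΛ<N·logm = ≤-respˡ-≈ (*-assoc _ _ _) (/-≤ (0<fromℕ N) (≤-respʳ-≈ (*-comm _ _) (<⇒≤ tΛ<N·logm)))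
        2≤m : ∀ m″ → m″ ≡ m′ → t * Λ < fromℕ N * log (fromℕ (suc m″)) → 2 ℕ.≤ m
        -- For `m = 1` the claimed bound is zero, and no `t ≥ 0` lies below it.
        2≤m zero    _      tΛ<N·log1 =
          ⊥-elim (<⇒≱ tΛ<N·log1 (≤-trans (≤-reflexive
            (trans (*-congˡ (log-exp (trans exp-0 (sym fromℕ-1)))) (zeroʳ _))) (*-nonNeg 0≤t (<⇒≤ 0<Λ))))
        2≤m (suc _) ≡.refl _ = ℕ.s≤s (ℕ.s≤s ℕ.z≤n)

      E-dimension : [ fromℕ N * log (fromℕ m) / Λ ] ≤∞ dimH E
      E-dimension = dimH-≥ E (fromℕ N * log (fromℕ m) / Λ) E-exponent

theorem1p13 : (lem : ∀ {ℓ} → ExcludedMiddle ℓ) (ℝ : RealField) →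
    let open RealField ℝ
        open Analysis lem ℝ
    in
    (N : ℕ) .{{_ : NonZero N}} (r : Fin N → Carrier) (δ : Carrier) →
    0# < δ → δ < fromℕ 3 ^ℤ (1ℤ ℤ.- + N) / fromℕ 18 →
    let E = ⋂ (Fin N) (λ i → Bad δ ⊕ r i)
        m = ⌊ (1# / (fromℕ 18 * δ * fromℕ 3 ^ℤ (+ N ℤ.- 1ℤ))) ^ʳ (1# / fromℕ N) ⌋
    in
    Dense E × ([ fromℕ N * log (fromℤ m) / log (1# / (fromℕ 6 * δ)) ] ≤∞ dimH E)
theorem1p13 lem ℝ (suc N′) r δ 0<δ δ<bound = E-dense r m′ m′+1≤root ,
  ≡.subst (λ i → [ fromℕ (suc N′) * log (fromℤ i) / Λ ] ≤∞ dimH (E r m′ m′+1≤root)) (≡.sym ⌊root⌋≡m′+1)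
    (E-dimension r m′ m′+1≤root)
  where
  open RealField ℝ
  open Analysis lem ℝ
  open DimensionBound lem ℝ
  open Constants N′ δ 0<δ δ<bound
  m′ = proj₁ (floor≥1 1≤root)
  ⌊root⌋≡m′+1 = proj₁ (proj₂ (floor≥1 1≤root))
  m′+1≤root = proj₂ (proj₂ (floor≥1 1≤root))
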